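{- Let $u$ be a positive integer with $u\equiv 3$ or $7 \pmod{10}$. Suppose that one of the following two conditions holds: (1) $v_2(u^2-1)$ is even; (2) there exists an odd prime $p$ with $p\equiv 2,3$ or $4\pmod 5$ such that $v_p(u+1)$ is odd or $v_p(u-1)$ is odd. Then there does not exist a $\left(\tfrac12(u^2+1),\ \tfrac14(u-1)^2,\ \tfrac18(u-1)(u-3)\right)$ cyclic difference set. Equivalently, there is no binary sequence $\mathbf a$ of period $n=\tfrac12(u^2+1)$ with $C_{\mathbf a}(t)=1$ for all $1\le t\le n-1$.
   Context: For a prime $p$ and a nonzero integer $m$, $v_p(m)$ denotes the exponent of the highest power of $p$ dividing $m$ ($v_p(0)=\infty$). An $(n,k,\lambda)$ cyclic difference set is a $k$-element subset $D$ of a cyclic group $G$ of order $n$ such that every non-identity element $g\in G$ has exactly $\lambda$ representations $g=xy^{ -1}$ with $x,y\in D$. A binary sequence of period $n$ is $\mathbf a=(a_0,a_1,\ldots)$ with $a_j\in\{ -1,1\}$, $a_{j+n}=a_j$; its autocorrelation values are $C_{\mathbf a}(t)=\sum_{i=0}^{n-1}a_ia_{i+t}$. -}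

module Defs where

open import Data.Nat using (ℕ; zero; suc; _+_; _*_; _∸_; _^_; _%_; _<_)
open import Data.Nat.Divisibility using (_∣_)
open import Data.Nat.Primality using (Prime)
open import Data.Fin using (Fin; toℕ)
open import Data.Fin.Subset using (Subset; _∈_; ∣_∣)
open import Data.List using (List; filter; length; allFin; cartesianProduct; upTo; map; foldr)
open import Data.Product using (_×_; _,_; ∃-syntax)
open import Data.Sum using (_⊎_)
open import Relation.Nullary using (¬_)
open import Relation.Binary.PropositionalEquality using (_≡_)
open import Data.Integer as ℤ using (ℤ)
open import Relation.Nullary.Decidable using (_×-dec_)
open import Data.Fin.Subset.Properties using (_∈?_)
open import Data.Nat.Properties using (_≟_)

-- p-adic valuation as a relation: v_p(m) = e  iff  p^e ∣ m and p^(e+1) ∤ m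
-- (used only for m ≠ 0, where e is unique)
HasVal : ℕ → ℕ → ℕ → Set
HasVal p m e = (p ^ e ∣ m) × ¬ (p ^ suc e ∣ m)

ValOdd : ℕ → ℕ → Set
ValOdd p m = ∃[ e ] (HasVal p m e × ¬ (2 ∣ e))

ValEven : ℕ → ℕ → Set
ValEven p m = ∃[ e ] (HasVal p m e × (2 ∣ e))

diffMod : (n : ℕ) → Fin n → Fin n → ℕ
diffMod zero () _
diffMod n@(suc _) x y = (toℕ x + (n ∸ toℕ y)) % n

reps : (n : ℕ) → Subset n → Fin n → ℕ
reps n D g = length (filter (λ xy → (Data.Product.proj₁ xy ∈? D) ×-dec (Data.Product.proj₂ xy ∈? D) ×-dec (diffMod n (Data.Product.proj₁ xy) (Data.Product.proj₂ xy) ≟ toℕ g))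
                            (cartesianProduct (allFin n) (allFin n)))

IsCyclicDiffSet : (n k lam : ℕ) → Subset n → Set
IsCyclicDiffSet n k lam D = (∣ D ∣ ≡ k) × ((g : Fin n) → ¬ (toℕ g ≡ 0) → reps n D g ≡ lam)

sumℤ : ℕ → (ℕ → ℤ) → ℤ
sumℤ n f = foldr (λ i acc → f i ℤ.+ acc) (ℤ.+ 0) (upTo n)

IsBinarySeq : ℕ → (ℕ → ℤ) → Set
IsBinarySeq n a = ((j : ℕ) → (a j ≡ ℤ.+ 1) ⊎ (a j ≡ ℤ.- (ℤ.+ 1))) × ((j : ℕ) → a (j + n) ≡ a j)

autocorr : ℕ → (ℕ → ℤ) → ℕ → ℤ
autocorr n a t = sumℤ n (λ i → a i ℤ.* a (i + t))

{-# OPTIONS --safe #-}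

-- Suppose f : ℕ → ℕ has period n with 5 ∣ n and its correlations at the shifts 1, …, n - 1 all equal
-- the one at 0 minus M. Summing f over the residue classes mod 5 gives d₀, …, d₄ with the analogous
-- property mod 5, i.e. α = Σ dⱼ ζʲ ∈ ℤ[ζ₅] satisfies α ᾱ = M. If p ≡ 2, 3, 4 (mod 5) is prime, then
-- -1 is a power of p mod 5, so modulo p conjugation is an iterate of Frobenius; as ℤ[ζ₅]/p is reduced,
-- p ∣ α ᾱ forces p ∣ α, and dividing M by p² repeatedly shows that v_p(M) is even.
-- Twice the indicator function of a difference set and a + 1 for a binary sequence a both give such an
-- f with 2 M = u² - 1, and under either condition v_p(M) is odd for some such p.

module Submission where

open import Defs
open import Algebra.Bundles using (CommutativeMonoid; CommutativeSemiring)
open import Algebra.Construct.DirectProduct using (commutativeMonoid)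
open import Algebra.Structures.Biased using (isCommutativeSemiringˡ)
open import Data.Bool using (Bool; true; false; if_then_else_; _∧_)
open import Data.Fin as Fin using (Fin; toℕ)
open import Data.Fin.Properties using (toℕ<n; toℕ-inject₁; toℕ-fromℕ; toℕ-fromℕ<; toℕ-injective; punchInᵢ≢i)
open import Data.Fin.Subset using (Subset; inside; outside; ∣_∣)
open import Data.Fin.Subset.Properties using (_∈?_)
open import Data.Integer as ℤ using (ℤ)
import Data.Integer.Properties as ℤ
import Data.Integer.Tactic.RingSolver as ℤ-Solver
open import Data.List using (_++_; filter; length; cartesianProduct; applyUpTo; map; foldr; tabulate)
open import Data.List.Properties using (length-++; filter-++; map-tabulate)
open import Data.Nat using (ℕ; zero; suc; _+_; _*_; _∸_; _^_; _%_; _/_; _≤_; _<_; z≤n; s≤s; NonZero)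
open import Data.Nat.Combinatorics using (_C_; nC1≡n; nCn≡1; k>n⇒nCk≡0; nCk+nC[k+1]≡[n+1]C[k+1])
open import Data.Nat.Divisibility
open import Data.Nat.DivMod
open import Data.Nat.Primality using (Prime; euclidsLemma; prime⇒nonZero; prime⇒irreducible; prime[2]; ¬prime[1])
open import Data.Nat.Properties
open import Data.Nat.Tactic.RingSolver using (solve-∀)
open import Data.Product using (_×_; _,_; proj₁; proj₂; ∃-syntax)
open import Data.Sum using (_⊎_; inj₁; inj₂)
open import Data.Vec using ([]; _∷_)
open import Function using (_∘_; _on_; id; case_of_)
open import Relation.Binary.PropositionalEquality as ≡ using (_≡_; _≢_; refl; sym; trans; cong; cong₂; subst)
open import Relation.Nullary using (¬_; contradiction; does)
open import Relation.Nullary.Decidable using (_×-dec_; dec-true; dec-false)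
open import Relation.Unary using (Pred; Decidable)
open import Algebra.Properties.CommutativeSemigroup +-commutativeSemigroup using (x∙yz≈y∙xz; xy∙z≈xz∙y)
open import Algebra.Properties.Semiring.Sum +-*-semiring
  using (sum; sum-cong-≗; sum-replicate-zero; ∑-comm; ∑-distrib-+; *-distribˡ-sum; sum-syntax; sum-remove)
import Algebra.Properties.CommutativeSemiring.Binomial as Binomial
import Algebra.Properties.CommutativeSemiring.Exp as Exp
import Algebra.Properties.Semiring.Mult as Mult
import Algebra.Properties.Semiring.Sum as Sum
import Algebra.Solver.Ring.NaturalCoefficients.Default as Solver
import Relation.Binary.Construct.On as On
import Relation.Binary.Reasoning.Setoid as SetoidReasoning

-- For odd u, u ≡ 3 or 7 (mod 10) holds exactly when u² ≡ -1 (mod 5), that is, when 5 divides n =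
-- (u² + 1) / 2. The argument stays in ℕ and in commutative semirings, so identities are arranged
-- without subtraction, and -1 enters as the residue p - 1. Let A, B, C be the cyclic correlations
-- of the dⱼ at shifts 0, 1, 2; shifts 3 and 4 repeat 2 and 1. Then α ᾱ = A + B (ζ + ζ⁴) + C (ζ² +
-- ζ³). Up to multiples, 1 + ζ + ζ² + ζ³ + ζ⁴ = 0 is the only linear relation, so this equals M
-- exactly when A - M = B = C. Likewise p ∣ α means that the dⱼ are congruent to one another mod p,
-- not that they vanish. Comparing coefficients mod p needs an explicit basis. With φ = ζ + ζ⁻¹ one
-- has φ² = 1 - φ, and ζ is a root of X² - φX + 1. So ℤ[ζ₅]/p is a tower of two quadratic extensions
-- of ℤ/p, with basis 1, φ, ζ, φζ and coordinatewise equality.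

corr₀ corr₁ corr₂ : (d₀ d₁ d₂ d₃ d₄ : ℕ) → ℕ
corr₀ d₀ d₁ d₂ d₃ d₄ = d₀ * d₀ + d₁ * d₁ + d₂ * d₂ + d₃ * d₃ + d₄ * d₄
corr₁ d₀ d₁ d₂ d₃ d₄ = d₀ * d₁ + d₁ * d₂ + d₂ * d₃ + d₃ * d₄ + d₄ * d₀
corr₂ d₀ d₁ d₂ d₃ d₄ = d₀ * d₂ + d₁ * d₃ + d₂ * d₄ + d₃ * d₀ + d₄ * d₁

-- M = α ᾱ for α = a + b ζ + c ζ² + d ζ³ + e ζ⁴.
Norm : ℕ → Set
Norm M = ∃[ a ] ∃[ b ] ∃[ c ] ∃[ d ] ∃[ e ]
  (corr₀ a b c d e ≡ corr₁ a b c d e + M) × (corr₀ a b c d e ≡ corr₂ a b c d e + M)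

-- For a prime p: -1 is a power of p modulo 5.
NegOneIsPower : ℕ → Set
NegOneIsPower p = p % 5 ≡ 2 ⊎ p % 5 ≡ 3 ⊎ p % 5 ≡ 4

-- Binomial coefficients modulo a prime

C-absorption : ∀ n k → suc k * (suc n C suc k) ≡ suc n * (n C k)
C-absorption zero    zero    = refl
C-absorption zero    (suc k) = trans
  (cong (suc (suc k) *_) (k>n⇒nCk≡0 {1} {suc (suc k)} (s≤s (s≤s z≤n))))
  (*-zeroʳ (suc (suc k)))
C-absorption (suc n) zero    = trans (*-identityˡ _)
  (trans (nC1≡n (suc (suc n))) (sym (*-identityʳ _)))
C-absorption (suc n) (suc k) = begin
  suc (suc k) * (suc (suc n) C suc (suc k))
    ≡⟨ cong (suc (suc k) *_) (nCk+nC[k+1]≡[n+1]C[k+1] (suc n) (suc k)) ⟨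
  suc (suc k) * (c + c′)
    ≡⟨ *-distribˡ-+ (suc (suc k)) c c′ ⟩
  (c + suc k * c) + suc (suc k) * c′
    ≡⟨ cong₂ (λ a b → (c + a) + b) (C-absorption n k) (C-absorption n (suc k)) ⟩
  (c + suc n * (n C k)) + suc n * (n C suc k)
    ≡⟨ +-assoc c _ _ ⟩
  c + (suc n * (n C k) + suc n * (n C suc k))
    ≡⟨ cong (c +_) (*-distribˡ-+ (suc n) (n C k) (n C suc k)) ⟨
  c + suc n * ((n C k) + (n C suc k))
    ≡⟨ cong (λ z → c + suc n * z) (nCk+nC[k+1]≡[n+1]C[k+1] n k) ⟩
  suc (suc n) * c ∎
  where
  open ≡.≡-Reasoning
  c  = suc n C suc k
  c′ = suc n C suc (suc k)

-- By absorption the prime divides `suc k` times the coefficient, and it cannot divide the smaller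
-- positive number `suc k`.
prime∣C : ∀ {n} → Prime (suc n) → ∀ k → suc k < suc n → suc n ∣ suc n C suc k
prime∣C {n} pr k k<n with euclidsLemma (suc k) (suc n C suc k) pr
                            (divides (n C k) (trans (C-absorption n k) (*-comm (suc n) (n C k))))
... | inj₁ p∣k = contradiction p∣k (>⇒∤ k<n)
... | inj₂ p∣C = p∣C

-- Frobenius in characteristic p

module Characteristic {a ℓ} (R : CommutativeSemiring a ℓ) {m : ℕ} (pr : Prime (suc m))
  (char : CommutativeSemiring._≈_ R
            (Mult._×_ (CommutativeSemiring.semiring R) (suc m) (CommutativeSemiring.1# R))
            (CommutativeSemiring.0# R)) where

  private
    module R = CommutativeSemiring R
    p = suc m

  open R using (Carrier; _≈_; 0#; 1#)
    renaming (_+_ to _⊕_; _*_ to _⊗_)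
  open Mult R.semiring renaming (_×_ to _·_)
  open Exp R using (^-congˡ; ^-homo-*; ^-assocʳ; ^-distrib-*) renaming (_^_ to _↑_)
  private module Σ = Sum R.semiring
  open SetoidReasoning R.setoid

  ι : ℕ → Carrier
  ι n = n · 1#

  ∣⇒·≈0 : ∀ {n} x → p ∣ n → n · x ≈ 0#
  ∣⇒·≈0 x (divides q refl) = begin
    (q * p) · x        ≡⟨ cong (_· x) (*-comm q p) ⟩
    (p * q) · x        ≈⟨ ×-assocˡ x p q ⟨
    p · (q · x)        ≈⟨ ×-congʳ p (R.*-identityˡ (q · x)) ⟨
    p · (1# ⊗ (q · x)) ≈⟨ ×-assoc-* p 1# (q · x) ⟨
    ι p ⊗ (q · x)      ≈⟨ R.*-congʳ char ⟩
    0# ⊗ (q · x)       ≈⟨ R.zeroˡ _ ⟩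
    0#                 ∎

  -- Only the two outer binomial terms survive. Since p is `suc m`, they are the head of the sum and
  -- the last term of its tail.
  freshman : ∀ x y → (x ⊕ y) ↑ p ≈ x ↑ p ⊕ y ↑ p
  freshman x y = begin
    (x ⊕ y) ↑ p                    ≈⟨ Binomial.theorem R p x y ⟩
    t Fin.zero ⊕ Σ.sum (t ∘ Fin.suc) ≈⟨ R.+-cong first (Σ.sum-init-last (t ∘ Fin.suc)) ⟩
    y ↑ p ⊕ (Σ.sum mid ⊕ t (Fin.suc (Fin.fromℕ m)))
      ≈⟨ R.+-congˡ (R.+-cong (R.trans (Σ.sum-cong-≋ middle) (Σ.sum-replicate-zero m)) last) ⟩
    y ↑ p ⊕ (0# ⊕ x ↑ p)           ≈⟨ R.+-congˡ (R.+-identityˡ _) ⟩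
    y ↑ p ⊕ x ↑ p                  ≈⟨ R.+-comm _ _ ⟩
    x ↑ p ⊕ y ↑ p                  ∎
    where
    t   = Binomial.binomialTerm R x y p
    mid = λ (i : Fin m) → t (Fin.suc (Fin.inject₁ i))

    first : t Fin.zero ≈ y ↑ p
    first = R.trans (×-homo-1 _) (R.*-identityˡ _)

    last : t (Fin.suc (Fin.fromℕ m)) ≈ x ↑ p
    last rewrite toℕ-fromℕ m | nCn≡1 p | n∸n≡0 m =
      R.trans (×-homo-1 _) (R.*-identityʳ _)

    middle : ∀ i → mid i ≈ 0#
    middle i = ∣⇒·≈0 _ (prime∣C pr (toℕ (Fin.inject₁ i))
      (s≤s (subst (_< m) (sym (toℕ-inject₁ i)) (toℕ<n i))))

  1↑ : ∀ n → 1# ↑ n ≈ 1#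
  1↑ zero    = R.refl
  1↑ (suc n) = R.trans (R.*-identityˡ _) (1↑ n)

  -- `ι n` is a sum of ones, so `freshman` gives this by induction. It lets Frobenius fix the
  -- integer coefficients in `ev`.
  fermat : ∀ n → ι n ↑ p ≈ ι n
  fermat zero    = R.zeroˡ _
  fermat (suc n) = begin
    (1# ⊕ ι n) ↑ p      ≈⟨ freshman 1# (ι n) ⟩
    1# ↑ p ⊕ ι n ↑ p    ≈⟨ R.+-cong (1↑ p) (fermat n) ⟩
    1# ⊕ ι n            ∎

  ι-+ : ∀ a b → ι (a + b) ≈ ι a ⊕ ι b
  ι-+ = ×-homo-+ 1#

  ι-* : ∀ a b → ι (a * b) ≈ ι a ⊗ ι b
  ι-* = ×1-homo-*

  -- For the vanishing of α the two relations on ζ suffice; linear independence enters only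
  -- afterwards, when coefficients are read off.
  module Conjugation (ζ : Carrier) (ζ⁵≈1 : ζ ↑ 5 ≈ 1#)
    (Φ₅ζ≈0 : 1# ⊕ (ζ ⊕ (ζ ↑ 2 ⊕ (ζ ↑ 3 ⊕ ζ ↑ 4))) ≈ 0#)
    (d₀ d₁ d₂ d₃ d₄ : ℕ) where

    ev : Carrier → Carrier
    ev z = ι d₀ ⊕ (ι d₁ ⊗ z ⊕ (ι d₂ ⊗ z ↑ 2 ⊕ (ι d₃ ⊗ z ↑ 3 ⊕ ι d₄ ⊗ z ↑ 4)))

    ev-cong : ∀ {x y} → x ≈ y → ev x ≈ ev y
    ev-cong eq = R.+-congˡ (R.+-cong (R.*-congˡ eq) (R.+-cong (R.*-congˡ (^-congˡ 2 eq))
      (R.+-cong (R.*-congˡ (^-congˡ 3 eq)) (R.*-congˡ (^-congˡ 4 eq)))))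

    -- Quantified over all z and not just ζ, so that it composes: the second factor in `frobenius-*`
    -- is applied at `z ↑ q`.
    Frobenius : ℕ → Set _
    Frobenius q = ∀ z → ev z ↑ q ≈ ev (z ↑ q)

    frobenius-p : Frobenius p
    frobenius-p z = begin
      ev z ↑ p ≈⟨ split (fermat d₀) (split (term d₁ 1 (R.*-identityʳ z)) (split (term d₂ 2 R.refl)
                    (split (term d₃ 3 R.refl) (term d₄ 4 R.refl)))) ⟩
      ι d₀ ⊕ (ι d₁ ⊗ ((z ↑ p) ↑ 1) ⊕ (ι d₂ ⊗ (z ↑ p) ↑ 2 ⊕ (ι d₃ ⊗ (z ↑ p) ↑ 3 ⊕ ι d₄ ⊗ (z ↑ p) ↑ 4)))
               ≈⟨ R.+-congˡ (R.+-congʳ (R.*-congˡ (R.*-identityʳ _))) ⟩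
      ev (z ↑ p) ∎
      where
      split : ∀ {x x′ y y′} → x ↑ p ≈ x′ → y ↑ p ≈ y′ → (x ⊕ y) ↑ p ≈ x′ ⊕ y′
      split e f = R.trans (freshman _ _) (R.+-cong e f)

      term : ∀ d {w} k → z ↑ k ≈ w → (ι d ⊗ w) ↑ p ≈ ι d ⊗ (z ↑ p) ↑ k
      term d {w} k eq = begin
        (ι d ⊗ w) ↑ p         ≈⟨ ^-distrib-* (ι d) w p ⟩
        ι d ↑ p ⊗ w ↑ p       ≈⟨ R.*-cong (fermat d) (^-congˡ p (R.sym eq)) ⟩
        ι d ⊗ (z ↑ k) ↑ p     ≈⟨ R.*-congˡ (^-assocʳ z k p) ⟩
        ι d ⊗ z ↑ (k * p)     ≡⟨ cong (λ e → ι d ⊗ z ↑ e) (*-comm k p) ⟩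
        ι d ⊗ z ↑ (p * k)     ≈⟨ R.*-congˡ (^-assocʳ z p k) ⟨
        ι d ⊗ (z ↑ p) ↑ k     ∎

    frobenius-* : ∀ {q r} → Frobenius q → Frobenius r → Frobenius (q * r)
    frobenius-* {q} {r} fq fr z = begin
      ev z ↑ (q * r)     ≈⟨ ^-assocʳ (ev z) q r ⟨
      (ev z ↑ q) ↑ r     ≈⟨ ^-congˡ r (fq z) ⟩
      ev (z ↑ q) ↑ r     ≈⟨ fr (z ↑ q) ⟩
      ev ((z ↑ q) ↑ r)   ≈⟨ ev-cong (^-assocʳ z q r) ⟩
      ev (z ↑ (q * r))   ∎

    ζ↑% : ∀ k → ζ ↑ k ≈ ζ ↑ (k % 5)
    ζ↑% k = begin
      ζ ↑ k                            ≡⟨ cong (ζ ↑_) (m≡m%n+[m/n]*n k 5) ⟩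
      ζ ↑ (k % 5 + k / 5 * 5)          ≈⟨ ^-homo-* ζ (k % 5) (k / 5 * 5) ⟩
      ζ ↑ (k % 5) ⊗ ζ ↑ (k / 5 * 5)    ≡⟨ cong (λ e → ζ ↑ (k % 5) ⊗ ζ ↑ e) (*-comm (k / 5) 5) ⟩
      ζ ↑ (k % 5) ⊗ ζ ↑ (5 * (k / 5))  ≈⟨ R.*-congˡ (^-assocʳ ζ 5 (k / 5)) ⟨
      ζ ↑ (k % 5) ⊗ (ζ ↑ 5) ↑ (k / 5)  ≈⟨ R.*-congˡ (R.trans (^-congˡ (k / 5) ζ⁵≈1) (1↑ (k / 5))) ⟩
      ζ ↑ (k % 5) ⊗ 1#                 ≈⟨ R.*-identityʳ _ ⟩
      ζ ↑ (k % 5)                      ∎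

    -- Complex conjugation sends ζ to its inverse, which is ζ⁴.
    α ᾱ : Carrier
    α = ev ζ
    ᾱ = ev (ζ ↑ 4)

    private
      A = corr₀ d₀ d₁ d₂ d₃ d₄
      B = corr₁ d₀ d₁ d₂ d₃ d₄
      C = corr₂ d₀ d₁ d₂ d₃ d₄

    ᾱ-reduced : ᾱ ≈ ι d₀ ⊕ (ι d₄ ⊗ ζ ⊕ (ι d₃ ⊗ ζ ↑ 2 ⊕ (ι d₂ ⊗ ζ ↑ 3 ⊕ ι d₁ ⊗ ζ ↑ 4)))
    ᾱ-reduced = begin
      ᾱ ≈⟨ R.+-congˡ (R.+-congˡ (R.+-cong (R.*-congˡ (pw 2)) (R.+-cong (R.*-congˡ (pw 3)) (R.*-congˡ (pw 4))))) ⟩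
      ι d₀ ⊕ (ι d₁ ⊗ ζ ↑ 4 ⊕ (ι d₂ ⊗ ζ ↑ 3 ⊕ (ι d₃ ⊗ ζ ↑ 2 ⊕ ι d₄ ⊗ ζ ↑ 1)))
        ≈⟨ solve 6 (λ a b c d e z →
             a :+ (b :* z :^ 4 :+ (c :* z :^ 3 :+ (d :* z :^ 2 :+ e :* z :^ 1)))
             := a :+ (e :* z :+ (d :* z :^ 2 :+ (c :* z :^ 3 :+ b :* z :^ 4))))
             R.refl (ι d₀) (ι d₁) (ι d₂) (ι d₃) (ι d₄) ζ ⟩
      ι d₀ ⊕ (ι d₄ ⊗ ζ ⊕ (ι d₃ ⊗ ζ ↑ 2 ⊕ (ι d₂ ⊗ ζ ↑ 3 ⊕ ι d₁ ⊗ ζ ↑ 4))) ∎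
      where
      open Solver R
      pw : ∀ k → (ζ ↑ 4) ↑ k ≈ ζ ↑ (4 * k % 5)
      pw k = R.trans (^-assocʳ ζ 4 k) (ζ↑% (4 * k))

    ι-dot : ∀ a₀ b₀ a₁ b₁ a₂ b₂ a₃ b₃ a₄ b₄ →
      ι (a₀ * b₀ + a₁ * b₁ + a₂ * b₂ + a₃ * b₃ + a₄ * b₄) ≈
      ι a₀ ⊗ ι b₀ ⊕ ι a₁ ⊗ ι b₁ ⊕ ι a₂ ⊗ ι b₂ ⊕ ι a₃ ⊗ ι b₃ ⊕ ι a₄ ⊗ ι b₄
    ι-dot a₀ b₀ a₁ b₁ a₂ b₂ a₃ b₃ a₄ b₄ =
      add (a₀ * b₀ + a₁ * b₁ + a₂ * b₂ + a₃ * b₃) a₄ b₄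
        (add (a₀ * b₀ + a₁ * b₁ + a₂ * b₂) a₃ b₃
          (add (a₀ * b₀ + a₁ * b₁) a₂ b₂
            (add (a₀ * b₀) a₁ b₁ (ι-* a₀ b₀))))
      where
      add : ∀ s a b {x} → ι s ≈ x → ι (s + a * b) ≈ x ⊕ ι a ⊗ ι b
      add s a b e = R.trans (ι-+ s (a * b)) (R.+-cong e (ι-* a b))

    norm : α ⊗ ᾱ ≈ ι A ⊕ (ι B ⊗ ζ ⊕ (ι C ⊗ ζ ↑ 2 ⊕ (ι C ⊗ ζ ↑ 3 ⊕ ι B ⊗ ζ ↑ 4)))
    norm = begin
      α ⊗ ᾱ ≈⟨ R.*-congˡ ᾱ-reduced ⟩
      -- The solver proves polynomial identities only, so the product is first cut at degree 5 into
      -- `lo` + `hi` z⁵; ζ⁵ = 1 is then used by hand.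
      _ ≈⟨ solve 6 (λ a b c d e z →
             (a :+ (b :* z :+ (c :* z :^ 2 :+ (d :* z :^ 3 :+ e :* z :^ 4)))) :*
             (a :+ (e :* z :+ (d :* z :^ 2 :+ (c :* z :^ 3 :+ b :* z :^ 4))))
             := lo a b c d e z :+ hi a b c d e z :* z :^ 5) R.refl e₀ e₁ e₂ e₃ e₄ ζ ⟩
      _ ≈⟨ R.+-congˡ (R.*-congˡ ζ⁵≈1) ⟩
      _ ≈⟨ solve 6 (λ a b c d e z → lo a b c d e z :+ hi a b c d e z :* con 1 :=
                a :* a :+ b :* b :+ c :* c :+ d :* d :+ e :* e :+
                ((a :* b :+ b :* c :+ c :* d :+ d :* e :+ e :* a) :* z :+
                ((a :* c :+ b :* d :+ c :* e :+ d :* a :+ e :* b) :* z :^ 2 :+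
                ((a :* c :+ b :* d :+ c :* e :+ d :* a :+ e :* b) :* z :^ 3 :+
                 (a :* b :+ b :* c :+ c :* d :+ d :* e :+ e :* a) :* z :^ 4))))
                R.refl e₀ e₁ e₂ e₃ e₄ ζ ⟩
      _ ≈⟨ R.+-cong ιA (R.+-cong (R.*-congʳ ιB) (R.+-cong (R.*-congʳ ιC)
             (R.+-cong (R.*-congʳ ιC) (R.*-congʳ ιB)))) ⟨
      ι A ⊕ (ι B ⊗ ζ ⊕ (ι C ⊗ ζ ↑ 2 ⊕ (ι C ⊗ ζ ↑ 3 ⊕ ι B ⊗ ζ ↑ 4))) ∎
      where
      open Solver R
      e₀ = ι d₀
      e₁ = ι d₁
      e₂ = ι d₂
      e₃ = ι d₃
      e₄ = ι d₄
      ιA = ι-dot d₀ d₀ d₁ d₁ d₂ d₂ d₃ d₃ d₄ d₄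
      ιB = ι-dot d₀ d₁ d₁ d₂ d₂ d₃ d₃ d₄ d₄ d₀
      ιC = ι-dot d₀ d₂ d₁ d₃ d₂ d₄ d₃ d₀ d₄ d₁

      lo hi : ∀ {n} (a b c d e z : Polynomial n) → Polynomial n
      lo a b c d e z = a :* a :+ ((a :* e :+ b :* a) :* z :+
        ((a :* d :+ b :* e :+ c :* a) :* z :^ 2 :+
        ((a :* c :+ b :* d :+ c :* e :+ d :* a) :* z :^ 3 :+
         (a :* b :+ b :* c :+ c :* d :+ d :* e :+ e :* a) :* z :^ 4)))
      hi a b c d e z = b :* b :+ c :* c :+ d :* d :+ e :* e :+
        ((c :* b :+ d :* c :+ e :* d) :* z :+
        ((d :* b :+ e :* c) :* z :^ 2 :+ e :* b :* z :^ 3))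

    -- Modulo p the three correlations coincide, so the norm is `ι A` times 1 + ζ + ζ² + ζ³ + ζ⁴.
    norm≈0 : ∀ {M} → p ∣ M → A ≡ B + M → A ≡ C + M → α ⊗ ᾱ ≈ 0#
    norm≈0 {M} p∣M A≡B+M A≡C+M = begin
      α ⊗ ᾱ ≈⟨ norm ⟩
      ι A ⊕ (ι B ⊗ ζ ⊕ (ι C ⊗ ζ ↑ 2 ⊕ (ι C ⊗ ζ ↑ 3 ⊕ ι B ⊗ ζ ↑ 4)))
        ≈⟨ R.+-congˡ (R.+-cong (R.*-congʳ (≈A A≡B+M)) (R.+-cong (R.*-congʳ (≈A A≡C+M))
             (R.+-cong (R.*-congʳ (≈A A≡C+M)) (R.*-congʳ (≈A A≡B+M))))) ⟩
      ι A ⊕ (ι A ⊗ ζ ⊕ (ι A ⊗ ζ ↑ 2 ⊕ (ι A ⊗ ζ ↑ 3 ⊕ ι A ⊗ ζ ↑ 4)))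
        ≈⟨ solve 2 (λ a z → a :+ (a :* z :+ (a :* z :^ 2 :+ (a :* z :^ 3 :+ a :* z :^ 4)))
             := a :* (con 1 :+ (z :+ (z :^ 2 :+ (z :^ 3 :+ z :^ 4))))) R.refl (ι A) ζ ⟩
      ι A ⊗ (1# ⊕ (ζ ⊕ (ζ ↑ 2 ⊕ (ζ ↑ 3 ⊕ ζ ↑ 4)))) ≈⟨ R.*-congˡ Φ₅ζ≈0 ⟩
      ι A ⊗ 0# ≈⟨ R.zeroʳ _ ⟩
      0# ∎
      where
      open Solver R
      ≈A : ∀ {X} → A ≡ X + M → ι X ≈ ι A
      ≈A {X} eq = begin
        ι X         ≈⟨ R.+-identityʳ _ ⟨
        ι X ⊕ 0#    ≈⟨ R.+-congˡ (∣⇒·≈0 1# p∣M) ⟨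
        ι X ⊕ ι M   ≈⟨ ι-+ X M ⟨
        ι (X + M)   ≡⟨ cong ι eq ⟨
        ι A         ∎

    -- α^q is the conjugate of α, so α^(q+1) = 0, whereas α^(q²) = α.
    self-conjugate⇒α≈0 : ∀ q → Frobenius q → q % 5 ≡ 4 → α ⊗ ᾱ ≈ 0# → α ≈ 0#
    self-conjugate⇒α≈0 q fq q%5≡4 αᾱ≈0 = begin
      α                          ≈⟨ ev-cong (R.*-identityʳ ζ) ⟨
      ev (ζ ↑ 1)                 ≡⟨ cong (λ k → ev (ζ ↑ k)) q*q%5 ⟨
      ev (ζ ↑ (q * q % 5))       ≈⟨ ev-cong (ζ↑% (q * q)) ⟨
      ev (ζ ↑ (q * q))           ≈⟨ frobenius-* {q} {q} fq fq ζ ⟨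
      α ↑ (q * q)                ≡⟨ cong (α ↑_) (trans (cong (λ x → x * x) q≡) (q² t)) ⟩
      α ↑ (suc (4 + t * 5) + s)  ≈⟨ ^-homo-* α (suc (4 + t * 5)) s ⟩
      α ↑ suc (4 + t * 5) ⊗ β    ≡⟨ cong (λ x → α ↑ suc x ⊗ β) q≡ ⟨
      (α ⊗ α ↑ q) ⊗ β            ≈⟨ R.*-congʳ (R.*-congˡ (R.trans (fq ζ) (ev-cong (ζ↑% q)))) ⟩
      (α ⊗ ev (ζ ↑ (q % 5))) ⊗ β ≡⟨ cong (λ k → (α ⊗ ev (ζ ↑ k)) ⊗ β) q%5≡4 ⟩
      (α ⊗ ᾱ) ⊗ β                ≈⟨ R.*-congʳ αᾱ≈0 ⟩
      0# ⊗ β                     ≈⟨ R.zeroˡ _ ⟩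
      0#                         ∎
      where
      t = q / 5
      -- This is q² - (q + 1) for q = 4 + 5t.
      s = 11 + 35 * t + 25 * t * t
      β = α ↑ s
      q≡ : q ≡ 4 + q / 5 * 5
      q≡ = trans (m≡m%n+[m/n]*n q 5) (cong (_+ q / 5 * 5) q%5≡4)
      q² : ∀ t → (4 + t * 5) * (4 + t * 5) ≡ suc (4 + t * 5) + (11 + 35 * t + 25 * t * t)
      q² = solve-∀
      q*q%5 : q * q % 5 ≡ 1
      q*q%5 = trans (%-distribˡ-* q q 5) (cong (λ r → (r * r) % 5) q%5≡4)

    -- The exponent q ≡ -1 (mod 5) is p² when p ≡ 2 or 3, because 2² ≡ 3² ≡ 4, and p itself when p ≡
    -- 4.
    α≈0 : ∀ {M} → p ∣ M → A ≡ B + M → A ≡ C + M →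
          NegOneIsPower p → α ≈ 0#
    α≈0 p∣M A≡B+M A≡C+M = λ
      { (inj₁ r)        → self-conjugate⇒α≈0 (p * p) (frobenius-* {p} {p} frobenius-p frobenius-p) (square r) z
      ; (inj₂ (inj₁ r)) → self-conjugate⇒α≈0 (p * p) (frobenius-* {p} {p} frobenius-p frobenius-p) (square r) z
      ; (inj₂ (inj₂ r)) → self-conjugate⇒α≈0 p frobenius-p r z
      }
      where
      z = norm≈0 p∣M A≡B+M A≡C+M
      square : ∀ {r} → p % 5 ≡ r → p * p % 5 ≡ r * r % 5
      square e = trans (%-distribˡ-* p p 5) (cong (λ r → (r * r) % 5) e)

-- The ring ℤ[ζ₅]/p

-- The free quadratic extension R[X]/(X² - λ′X - κ); the pair (x , y) stands for x + yX.
module Quadratic {a ℓ} (R : CommutativeSemiring a ℓ) (κ λ′ : CommutativeSemiring.Carrier R) where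
  private module R = CommutativeSemiring R
  open R using (Carrier; 0#; 1#) renaming (_≈_ to _≈₁_; _+_ to _⊕_; _*_ to _⊗_)
  open Solver R

  _≋_ : Carrier × Carrier → Carrier × Carrier → Set _
  (x , y) ≋ (x′ , y′) = (x ≈₁ x′) × (y ≈₁ y′)

  _⊞_ _⊠_ : Carrier × Carrier → Carrier × Carrier → Carrier × Carrier
  (x , y) ⊞ (x′ , y′) = x ⊕ x′ , y ⊕ y′
  (x , y) ⊠ (x′ , y′) = x ⊗ x′ ⊕ κ ⊗ (y ⊗ y′) , x ⊗ y′ ⊕ y ⊗ x′ ⊕ λ′ ⊗ (y ⊗ y′)

  private
    fst snd : ∀ {n} (k l x y x′ y′ : Polynomial n) → Polynomial n
    fst k l x y x′ y′ = x :* x′ :+ k :* (y :* y′)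
    snd k l x y x′ y′ = x :* y′ :+ y :* x′ :+ l :* (y :* y′)

  extension : CommutativeSemiring a ℓ
  extension = record
    { Carrier = Carrier × Carrier
    ; _≈_ = _≋_
    ; _+_ = _⊞_
    ; _*_ = _⊠_
    ; 0# = 0# , 0#
    ; 1# = 1# , 0#
    ; isCommutativeSemiring = isCommutativeSemiringˡ record
      { +-isCommutativeMonoid = ⊞.isCommutativeMonoid
      ; *-isCommutativeMonoid = record
        { isMonoid = record
          { isSemigroup = record
            { isMagma = record
              { isEquivalence = ⊞.isEquivalence
              ; ∙-cong = λ (e , f) (e′ , f′) →
                  R.+-cong (R.*-cong e e′) (R.*-congˡ (R.*-cong f f′)) ,
                  R.+-cong (R.+-cong (R.*-cong e f′) (R.*-cong f e′)) (R.*-congˡ (R.*-cong f f′))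
              }
            ; assoc = λ (x , y) (x′ , y′) (x″ , y″) →
                solve 8 (λ x y x′ y′ x″ y″ k l → fst k l (fst k l x y x′ y′) (snd k l x y x′ y′) x″ y″
                  := fst k l x y (fst k l x′ y′ x″ y″) (snd k l x′ y′ x″ y″)) R.refl x y x′ y′ x″ y″ κ λ′ ,
                solve 8 (λ x y x′ y′ x″ y″ k l → snd k l (fst k l x y x′ y′) (snd k l x y x′ y′) x″ y″
                  := snd k l x y (fst k l x′ y′ x″ y″) (snd k l x′ y′ x″ y″)) R.refl x y x′ y′ x″ y″ κ λ′
            }
          ; identity = (λ (x , y) → oneˡ x y , oneʳ x y) ,
              λ (x , y) → R.trans (comm₁ x y 1# 0#) (oneˡ x y) , R.trans (comm₂ x y 1# 0#) (oneʳ x y)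
          }
        ; comm = λ (x , y) (x′ , y′) → comm₁ x y x′ y′ , comm₂ x y x′ y′
        }
      ; distribʳ = λ (x , y) (x′ , y′) (x″ , y″) →
          solve 8 (λ x y x′ y′ x″ y″ k l → fst k l (x′ :+ x″) (y′ :+ y″) x y
            := fst k l x′ y′ x y :+ fst k l x″ y″ x y) R.refl x y x′ y′ x″ y″ κ λ′ ,
          solve 8 (λ x y x′ y′ x″ y″ k l → snd k l (x′ :+ x″) (y′ :+ y″) x y
            := snd k l x′ y′ x y :+ snd k l x″ y″ x y) R.refl x y x′ y′ x″ y″ κ λ′
      ; zeroˡ = λ (x , y) →
          solve 4 (λ x y k l → fst k l (con 0) (con 0) x y := con 0) R.refl x y κ λ′ ,
          solve 4 (λ x y k l → snd k l (con 0) (con 0) x y := con 0) R.refl x y κ λ′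
      }
    }
    where
    module ⊞ = CommutativeMonoid (commutativeMonoid R.+-commutativeMonoid R.+-commutativeMonoid)

    comm₁ : ∀ x y x′ y′ → x ⊗ x′ ⊕ κ ⊗ (y ⊗ y′) ≈₁ x′ ⊗ x ⊕ κ ⊗ (y′ ⊗ y)
    comm₁ x y x′ y′ = solve 6 (λ x y x′ y′ k l → fst k l x y x′ y′ := fst k l x′ y′ x y)
      R.refl x y x′ y′ κ λ′

    comm₂ : ∀ x y x′ y′ → x ⊗ y′ ⊕ y ⊗ x′ ⊕ λ′ ⊗ (y ⊗ y′) ≈₁ x′ ⊗ y ⊕ y′ ⊗ x ⊕ λ′ ⊗ (y′ ⊗ y)
    comm₂ x y x′ y′ = solve 6 (λ x y x′ y′ k l → snd k l x y x′ y′ := snd k l x′ y′ x y)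
      R.refl x y x′ y′ κ λ′

    oneˡ : ∀ x y → 1# ⊗ x ⊕ κ ⊗ (0# ⊗ y) ≈₁ x
    oneˡ x y = solve 4 (λ x y k l → fst k l (con 1) (con 0) x y := x) R.refl x y κ λ′

    oneʳ : ∀ x y → 1# ⊗ y ⊕ 0# ⊗ x ⊕ λ′ ⊗ (0# ⊗ y) ≈₁ y
    oneʳ x y = solve 4 (λ x y k l → snd k l (con 1) (con 0) x y := y) R.refl x y κ λ′

  private
    module E = CommutativeSemiring extension
    module MR = Mult R.semiring
    module ME = Mult E.semiring

  X : Carrier × Carrier
  X = 0# , 1#

  ·1 : ∀ n → (n ME.× E.1#) E.≈ (n MR.× 1# , 0#)
  ·1 zero    = R.refl , R.refl
  ·1 (suc n) = R.+-congˡ (proj₁ (·1 n)) , R.trans (R.+-identityˡ _) (proj₂ (·1 n))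

  X* : ∀ x y → (X ⊠ (x , y)) E.≈ (κ ⊗ y , x ⊕ λ′ ⊗ y)
  X* x y =
    solve 4 (λ x y k l → fst k l (con 0) (con 1) x y := k :* y) R.refl x y κ λ′ ,
    solve 4 (λ x y k l → snd k l (con 0) (con 1) x y := x :+ l :* y) R.refl x y κ λ′

  scalar* : ∀ e x y → ((e , 0#) ⊠ (x , y)) E.≈ (e ⊗ x , e ⊗ y)
  scalar* e x y =
    solve 5 (λ e x y k l → e :* x :+ k :* (con 0 :* y) := e :* x) R.refl e x y κ λ′ ,
    solve 5 (λ e x y k l → e :* y :+ con 0 :* x :+ l :* (con 0 :* y) := e :* y) R.refl e x y κ λ′

-- R[φ][ζ] with φ² = 1 - φ and ζ² = φζ - 1, where μ plays the role of -1; then φ = ζ + ζ⁻¹.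
module Cyclotomic {a ℓ} (R : CommutativeSemiring a ℓ) (μ : CommutativeSemiring.Carrier R)
  (μ+1≈0 : CommutativeSemiring._≈_ R
             (CommutativeSemiring._+_ R μ (CommutativeSemiring.1# R)) (CommutativeSemiring.0# R)) where

  private module R = CommutativeSemiring R
  open R using (Carrier; 0#; 1#; _≈_) renaming (_+_ to _⊕_; _*_ to _⊗_)

  private
    -- An element ((w , x) , (y , z)) of the tower stands for w + xφ + yζ + zφζ.
    module Q₁ = Quadratic R 1# μ
    module Q₂ = Quadratic Q₁.extension (μ , 0#) Q₁.X

  R[ζ] : CommutativeSemiring a ℓ
  R[ζ] = Q₂.extension

  module R₁ = CommutativeSemiring Q₁.extension
  module R₂ = CommutativeSemiring R[ζ]
  open Exp R[ζ] renaming (_^_ to _↑_)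

  ζ : R₂.Carrier
  ζ = Q₂.X

  -- Uses ζ² = φζ - 1 and (y + zφ)φ = z + (y - z)φ. Taking `v` up to equality lets each power of ζ
  -- be simplified before the next multiplication.
  ζ* : ∀ {w x y z} v → v R₂.≈ ((w , x) , (y , z)) →
       (ζ R₂.* v) R₂.≈ ((μ ⊗ y , μ ⊗ z) , (w ⊕ z , x ⊕ (y ⊕ μ ⊗ z)))
  ζ* {w} {x} {y} {z} v eq = R₂.trans (R₂.*-congˡ {ζ} eq) (R₂.trans (Q₂.X* (w , x) (y , z))
    (Q₁.scalar* μ y z ,
     R₁.+-congˡ {w , x} (R₁.trans (Q₁.X* y z) (R.*-identityˡ z , R.refl))))

  ⟨1+μ⟩ : 1# ⊕ μ ≈ 0#
  ⟨1+μ⟩ = R.trans (R.+-comm 1# μ) μ+1≈0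

  cancel : ∀ x → x ⊕ μ ⊗ x ≈ 0#
  cancel x = begin
    x ⊕ μ ⊗ x       ≈⟨ R.+-congʳ (R.*-identityˡ x) ⟨
    1# ⊗ x ⊕ μ ⊗ x  ≈⟨ R.distribʳ x 1# μ ⟨
    (1# ⊕ μ) ⊗ x    ≈⟨ R.*-congʳ ⟨1+μ⟩ ⟩
    0# ⊗ x          ≈⟨ R.zeroˡ x ⟩
    0#              ∎
    where open SetoidReasoning R.setoid

  μ*μ : μ ⊗ μ ≈ 1#
  μ*μ = begin
    μ ⊗ μ              ≈⟨ R.+-identityˡ _ ⟨
    0# ⊕ μ ⊗ μ         ≈⟨ R.+-congʳ ⟨1+μ⟩ ⟨
    (1# ⊕ μ) ⊕ μ ⊗ μ   ≈⟨ R.+-assoc 1# μ _ ⟩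
    1# ⊕ (μ ⊕ μ ⊗ μ)   ≈⟨ R.+-congˡ (cancel μ) ⟩
    1# ⊕ 0#            ≈⟨ R.+-identityʳ 1# ⟩
    1#                 ∎
    where open SetoidReasoning R.setoid

  private
    μ0≈0 : μ ⊗ 0# ≈ 0#
    μ0≈0 = R.zeroʳ μ
    μ1≈μ : μ ⊗ 1# ≈ μ
    μ1≈μ = R.*-identityʳ μ
    dropˡ : ∀ {x y z} → x ≈ 0# → y ≈ z → x ⊕ y ≈ z
    dropˡ e f = R.trans (R.+-cong e f) (R.+-identityˡ _)
    dropʳ : ∀ {x y z} → x ≈ z → y ≈ 0# → x ⊕ y ≈ z
    dropʳ e f = R.trans (R.+-cong e f) (R.+-identityʳ _)

  ζ¹ : (ζ ↑ 1) R₂.≈ ((0# , 0#) , (1# , 0#))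
  ζ¹ = R₂.*-identityʳ ζ

  ζ² : (ζ ↑ 2) R₂.≈ ((μ , 0#) , (0# , 1#))
  ζ² = R₂.trans (ζ* (ζ ↑ 1) ζ¹) ((μ1≈μ , μ0≈0) , (dropˡ R.refl R.refl , dropˡ R.refl (dropʳ R.refl μ0≈0)))

  ζ³ : (ζ ↑ 3) R₂.≈ ((0# , μ) , (0# , μ))
  ζ³ = R₂.trans (ζ* (ζ ↑ 2) ζ²) ((μ0≈0 , μ1≈μ) , (μ+1≈0 , dropˡ R.refl (dropˡ R.refl μ1≈μ)))

  ζ⁴ : (ζ ↑ 4) R₂.≈ ((0# , 1#) , (μ , 0#))
  ζ⁴ = R₂.trans (ζ* (ζ ↑ 3) ζ³) ((μ0≈0 , μ*μ) , (dropˡ R.refl R.refl , R.trans (R.+-congˡ (R.+-identityˡ _)) (cancel μ)))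

  ζ⁵≈1 : (ζ ↑ 5) R₂.≈ R₂.1#
  ζ⁵≈1 = R₂.trans (ζ* (ζ ↑ 4) ζ⁴) ((μ*μ , μ0≈0) , (dropˡ R.refl R.refl , R.trans (R.+-congˡ (dropʳ R.refl μ0≈0)) ⟨1+μ⟩))

  sum-coordinates : ∀ {t₀ t₁ t₂ t₃ t₄ a a′ b b′ c c′ d d′ e e′ f f′ g g′ h h′ i i′ j j′} →
    t₀ R₂.≈ ((a , b) , (a′ , b′)) → t₁ R₂.≈ ((c , d) , (c′ , d′)) → t₂ R₂.≈ ((e , f) , (e′ , f′)) →
    t₃ R₂.≈ ((g , h) , (g′ , h′)) → t₄ R₂.≈ ((i , j) , (i′ , j′)) →
    (t₀ R₂.+ (t₁ R₂.+ (t₂ R₂.+ (t₃ R₂.+ t₄)))) R₂.≈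
    ((a ⊕ (c ⊕ (e ⊕ (g ⊕ i))) , b ⊕ (d ⊕ (f ⊕ (h ⊕ j)))) ,
     (a′ ⊕ (c′ ⊕ (e′ ⊕ (g′ ⊕ i′))) , b′ ⊕ (d′ ⊕ (f′ ⊕ (h′ ⊕ j′)))))
  sum-coordinates {t₀} {t₁} {t₂} {t₃} p q r s t =
    R₂.+-cong {t₀} p (R₂.+-cong {t₁} q (R₂.+-cong {t₂} r (R₂.+-cong {t₃} s t)))

  Φ₅ζ≈0 : (R₂.1# R₂.+ (ζ R₂.+ (ζ ↑ 2 R₂.+ (ζ ↑ 3 R₂.+ ζ ↑ 4)))) R₂.≈ R₂.0#
  Φ₅ζ≈0 = R₂.trans
    (sum-coordinates (R₂.refl {R₂.1#}) (R₂.refl {ζ}) ζ² ζ³ ζ⁴)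
    ((R.trans (R.+-congˡ (dropˡ R.refl (dropʳ R.refl (dropˡ R.refl R.refl)))) ⟨1+μ⟩ ,
      dropˡ R.refl (dropˡ R.refl (dropˡ R.refl μ+1≈0))) ,
     (dropˡ R.refl (R.trans (R.+-congˡ (dropˡ R.refl (dropˡ R.refl R.refl))) ⟨1+μ⟩) ,
      dropˡ R.refl (dropˡ R.refl (R.trans (R.+-congˡ (dropʳ R.refl R.refl)) ⟨1+μ⟩))))

  private
    module MR = Mult R.semiring
    module M₂ = Mult R₂.semiring

  ·1 : ∀ n → (n M₂.× R₂.1#) R₂.≈ ((n MR.× 1# , 0#) , (0# , 0#))
  ·1 n = R₂.trans (Q₂.·1 n) (Q₁.·1 n , R₁.refl)

  characteristic : ∀ n → n MR.× 1# ≈ 0# → (n M₂.× R₂.1#) R₂.≈ R₂.0#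
  characteristic n n·1≈0 = R₂.trans (·1 n) ((n·1≈0 , R.refl) , (R.refl , R.refl))

  term : ∀ n {v w x y z} → v R₂.≈ ((w , x) , (y , z)) → let e = n MR.× 1# in
         ((n M₂.× R₂.1#) R₂.* v) R₂.≈ ((e ⊗ w , e ⊗ x) , (e ⊗ y , e ⊗ z))
  term n {v} {w} {x} {y} {z} eq =
    R₂.trans (R₂.*-cong {n M₂.× R₂.1#} (·1 n) eq)
      (R₂.trans (Q₂.scalar* (n MR.× 1# , 0#) (w , x) (y , z))
        (Q₁.scalar* (n MR.× 1#) w x , Q₁.scalar* (n MR.× 1#) y z))

  -- 1, ζ, φ, φζ are independent over R and ζ² = φζ - 1, ζ³ = -φ - φζ, ζ⁴ = φ - ζ.
  independent : ∀ d₀ d₁ d₂ d₃ d₄ → let e = M₂._× R₂.1#; ι = MR._× 1# in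
    (e d₀ R₂.+ (e d₁ R₂.* ζ R₂.+ (e d₂ R₂.* ζ ↑ 2 R₂.+ (e d₃ R₂.* ζ ↑ 3 R₂.+ e d₄ R₂.* ζ ↑ 4)))) R₂.≈ R₂.0# →
    ι d₀ ≈ ι d₁ × ι d₀ ≈ ι d₂ × ι d₀ ≈ ι d₃ × ι d₀ ≈ ι d₄
  independent d₀ d₁ d₂ d₃ d₄ eq = R.trans d₀≈d₄ (R.sym d₁≈d₄) , d₀≈d₂ , d₀≈d₃ , d₀≈d₄
    where
    open Solver R
    ι = MR._× 1#
    e₀ = ι d₀
    e₁ = ι d₁
    e₂ = ι d₂
    e₃ = ι d₃
    e₄ = ι d₄

    expansion : _ R₂.≈ _
    expansion = sum-coordinates (·1 d₀) (term d₁ {ζ} R₂.refl) (term d₂ {ζ ↑ 2} ζ²)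
      (term d₃ {ζ ↑ 3} ζ³) (term d₄ {ζ ↑ 4} ζ⁴)

    -- The coefficients of 1, φ, ζ, φζ are d₀ - d₂, d₄ - d₃, d₁ - d₄, d₂ - d₃; their vanishing links
    -- all five in the chain d₀, d₂, d₃, d₄, d₁.
    c₁ : e₀ ⊕ e₂ ⊗ μ ≈ 0#
    c₁ = R.trans (R.sym (R.trans (proj₁ (proj₁ expansion))
      (solve 6 (λ a b c d e μ → a :+ (b :* con 0 :+ (c :* μ :+ (d :* con 0 :+ e :* con 0)))
          := a :+ c :* μ) R.refl e₀ e₁ e₂ e₃ e₄ μ))) (proj₁ (proj₁ eq))

    c₂ : e₄ ⊕ e₃ ⊗ μ ≈ 0#
    c₂ = R.trans (R.sym (R.trans (proj₂ (proj₁ expansion))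
      (solve 6 (λ a b c d e μ → con 0 :+ (b :* con 0 :+ (c :* con 0 :+ (d :* μ :+ e :* con 1)))
          := e :+ d :* μ) R.refl e₀ e₁ e₂ e₃ e₄ μ))) (proj₂ (proj₁ eq))

    c₃ : e₁ ⊕ e₄ ⊗ μ ≈ 0#
    c₃ = R.trans (R.sym (R.trans (proj₁ (proj₂ expansion))
      (solve 6 (λ a b c d e μ → con 0 :+ (b :* con 1 :+ (c :* con 0 :+ (d :* con 0 :+ e :* μ)))
          := b :+ e :* μ) R.refl e₀ e₁ e₂ e₃ e₄ μ))) (proj₁ (proj₂ eq))

    c₄ : e₂ ⊕ e₃ ⊗ μ ≈ 0#
    c₄ = R.trans (R.sym (R.trans (proj₂ (proj₂ expansion))
      (solve 6 (λ a b c d e μ → con 0 :+ (b :* con 0 :+ (c :* con 1 :+ (d :* μ :+ e :* con 0)))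
          := c :+ d :* μ) R.refl e₀ e₁ e₂ e₃ e₄ μ))) (proj₂ (proj₂ eq))

    equal : ∀ {x y} → x ⊕ y ⊗ μ ≈ 0# → x ≈ y
    equal {x} {y} x+yμ≈0 = begin
      x                 ≈⟨ R.+-identityʳ x ⟨
      x ⊕ 0#            ≈⟨ R.+-congˡ (cancel y) ⟨
      x ⊕ (y ⊕ μ ⊗ y)   ≈⟨ solve 3 (λ x y μ → x :+ (y :+ μ :* y) := (x :+ y :* μ) :+ y) R.refl x y μ ⟩
      (x ⊕ y ⊗ μ) ⊕ y   ≈⟨ R.+-congʳ x+yμ≈0 ⟩
      0# ⊕ y            ≈⟨ R.+-identityˡ y ⟩
      y                 ∎
      where open SetoidReasoning R.setoid

    d₀≈d₂ = equal c₁
    d₄≈d₃ = equal c₂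
    d₁≈d₄ = equal c₃
    d₂≈d₃ = equal c₄
    d₀≈d₃ = R.trans d₀≈d₂ d₂≈d₃
    d₀≈d₄ = R.trans d₀≈d₃ (R.sym d₄≈d₃)

-- Residues are arbitrary naturals under a coarser equality, so the laws are inherited from ℕ and
-- only congruence of the operations needs work.
ℕ-mod : (n : ℕ) .{{_ : NonZero n}} → CommutativeSemiring _ _
ℕ-mod n = record
  { Carrier = ℕ
  ; _≈_ = _≡_ on (_% n)
  ; _+_ = _+_
  ; _*_ = _*_
  ; 0# = 0
  ; 1# = 1
  ; isCommutativeSemiring = isCommutativeSemiringˡ record
    { +-isCommutativeMonoid = record
      { isMonoid = record
        { isSemigroup = record
          { isMagma = record
            { isEquivalence = isEq
            ; ∙-cong = λ {a} {b} {c} {d} e f → trans (%-distribˡ-+ a c n)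
                (trans (cong₂ (λ x y → (x + y) % n) e f) (sym (%-distribˡ-+ b d n)))
            }
          ; assoc = λ a b c → cong (_% n) (+-assoc a b c)
          }
        ; identity = (λ _ → refl) , (λ a → cong (_% n) (+-identityʳ a))
        }
      ; comm = λ a b → cong (_% n) (+-comm a b)
      }
    ; *-isCommutativeMonoid = record
      { isMonoid = record
        { isSemigroup = record
          { isMagma = record
            { isEquivalence = isEq
            ; ∙-cong = λ {a} {b} {c} {d} e f → trans (%-distribˡ-* a c n)
                (trans (cong₂ (λ x y → (x * y) % n) e f) (sym (%-distribˡ-* b d n)))
            }
          ; assoc = λ a b c → cong (_% n) (*-assoc a b c)
          }
        ; identity = (λ a → cong (_% n) (*-identityˡ a)) , (λ a → cong (_% n) (*-identityʳ a))
        }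
      ; comm = λ a b → cong (_% n) (*-comm a b)
      }
    ; distribʳ = λ a b c → cong (_% n) (*-distribʳ-+ a b c)
    ; zeroˡ = λ _ → refl
    }
  }
  where
  isEq = On.isEquivalence (_% n) ≡.isEquivalence

-- Descent: dividing a norm by p²

-- This is p ∣ α in coordinates: α vanishes in ℤ[ζ₅]/p, and independence then makes the five
-- coefficients agree.
norm-congruence : ∀ {p} .{{_ : NonZero p}} → Prime p → NegOneIsPower p → ∀ d₀ d₁ d₂ d₃ d₄ {M} → p ∣ M →
  corr₀ d₀ d₁ d₂ d₃ d₄ ≡ corr₁ d₀ d₁ d₂ d₃ d₄ + M →
  corr₀ d₀ d₁ d₂ d₃ d₄ ≡ corr₂ d₀ d₁ d₂ d₃ d₄ + M →
  d₁ % p ≡ d₀ % p × d₂ % p ≡ d₀ % p × d₃ % p ≡ d₀ % p × d₄ % p ≡ d₀ % p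
norm-congruence {p@(suc m)} pr inert d₀ d₁ d₂ d₃ d₄ p∣M e f =
  let e₁ , e₂ , e₃ , e₄ = ℤ/p[ζ].independent d₀ d₁ d₂ d₃ d₄ (α≈0 p∣M e f inert)
  in reduce d₁ e₁ , reduce d₂ e₂ , reduce d₃ e₃ , reduce d₄ e₄
  where
  module ℤ/p[ζ] = Cyclotomic (ℕ-mod p) m (trans (cong (_% p) (+-comm m 1)) (n%n≡0 p))

  _·1 : ℕ → ℕ
  n ·1 = Mult._×_ (CommutativeSemiring.semiring (ℕ-mod p)) n 1

  ·1≡ : ∀ n → n ·1 ≡ n
  ·1≡ zero    = refl
  ·1≡ (suc n) = cong suc (·1≡ n)

  p·1≈0 : (p ·1) % p ≡ 0
  p·1≈0 = trans (cong (_% p) (·1≡ p)) (n%n≡0 p)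

  open Characteristic ℤ/p[ζ].R[ζ] pr (ℤ/p[ζ].characteristic p p·1≈0)
  open Conjugation ℤ/p[ζ].ζ ℤ/p[ζ].ζ⁵≈1 ℤ/p[ζ].Φ₅ζ≈0 d₀ d₁ d₂ d₃ d₄

  reduce : ∀ x → (d₀ ·1) % p ≡ (x ·1) % p → x % p ≡ d₀ % p
  reduce x eq = trans (cong (_% p) (sym (·1≡ x))) (trans (sym eq) (cong (_% p) (·1≡ d₀)))

module _ (r p : ℕ) where
  -- The part of a correlation that involves the common remainder r. Every index occurs once in each
  -- factor, so it is the same at all shifts and cancels from the norm equations.
  common : (a b c d e : ℕ) → ℕ
  common a b c d e = 5 * (r * r) + 2 * (r * p * (a + b + c + d + e))

  private
    lift : ℕ → ℕ
    lift q = r + q * p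

    expand₀ : ∀ r p a b c d e →
      (r + a * p) * (r + a * p) +
      (r + b * p) * (r + b * p) +
      (r + c * p) * (r + c * p) +
      (r + d * p) * (r + d * p) +
      (r + e * p) * (r + e * p) ≡
      5 * (r * r) + 2 * (r * p * (a + b + c + d + e)) +
      (a * a + b * b + c * c + d * d + e * e) * (p * p)
    expand₀ = solve-∀

    expand₁ : ∀ r p a b c d e →
      (r + a * p) * (r + b * p) +
      (r + b * p) * (r + c * p) +
      (r + c * p) * (r + d * p) +
      (r + d * p) * (r + e * p) +
      (r + e * p) * (r + a * p) ≡
      5 * (r * r) + 2 * (r * p * (a + b + c + d + e)) +
      (a * b + b * c + c * d + d * e + e * a) * (p * p)
    expand₁ = solve-∀

    expand₂ : ∀ r p a b c d e →
      (r + a * p) * (r + c * p) +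
      (r + b * p) * (r + d * p) +
      (r + c * p) * (r + e * p) +
      (r + d * p) * (r + a * p) +
      (r + e * p) * (r + b * p) ≡
      5 * (r * r) + 2 * (r * p * (a + b + c + d + e)) +
      (a * c + b * d + c * e + d * a + e * b) * (p * p)
    expand₂ = solve-∀

  corr₀-lift : ∀ a b c d e → corr₀ (lift a) (lift b) (lift c) (lift d) (lift e) ≡
    common a b c d e + corr₀ a b c d e * (p * p)
  corr₀-lift = expand₀ r p

  corr₁-lift : ∀ a b c d e → corr₁ (lift a) (lift b) (lift c) (lift d) (lift e) ≡
    common a b c d e + corr₁ a b c d e * (p * p)
  corr₁-lift = expand₁ r p

  corr₂-lift : ∀ a b c d e → corr₂ (lift a) (lift b) (lift c) (lift d) (lift e) ≡
    common a b c d e + corr₂ a b c d e * (p * p)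
  corr₂-lift = expand₂ r p

p*x*[p*p] : ∀ p x → p * x * (p * p) ≡ p * (p * (p * x))
p*x*[p*p] = solve-∀

m*[n*n]∣⇒m∣ : ∀ {p} .{{_ : NonZero p}} e M → p ^ (2 + e) ∣ M * (p * p) → p ^ e ∣ M
m*[n*n]∣⇒m∣ {p} e M d = *-cancelʳ-∣ (p * p) {{m*n≢0 p p}} (subst (_∣ M * (p * p)) (swap p (p ^ e)) d)
  where
  swap : ∀ p x → p * (p * x) ≡ x * (p * p)
  swap = solve-∀

module _ {p : ℕ} .{{_ : NonZero p}} (pr : Prime p) (inert : NegOneIsPower p) where

  -- With dⱼ = r + qⱼ p, the remainder contributes r (1 + ζ + ζ² + ζ³ + ζ⁴) = 0, so the quotients qⱼ
  -- are the coefficients of α / p.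
  descent : ∀ {M} → Norm M → p ∣ M → ∃[ N ] (M ≡ N * (p * p)) × Norm N
  descent {M} (d₀ , d₁ , d₂ , d₃ , d₄ , e₁ , e₂) p∣M =
    let r₁ , r₂ , r₃ , r₄ = norm-congruence pr inert d₀ d₁ d₂ d₃ d₄ p∣M e₁ e₂
        f = λ (corr : ℕ → ℕ → ℕ → ℕ → ℕ → ℕ) → reduce corr refl r₁ r₂ r₃ r₄
        A₀ = trans (sym (corr₀-lift r p q₀ q₁ q₂ q₃ q₄)) (f corr₀)
        B₀ = trans (sym (corr₁-lift r p q₀ q₁ q₂ q₃ q₄)) (f corr₁)
        C₀ = trans (sym (corr₂-lift r p q₀ q₁ q₂ q₃ q₄)) (f corr₂)
        eqB = strip K c₀ c₁ (trans A₀ (trans e₁ (cong (_+ M) (sym B₀))))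
        eqC = strip K c₀ c₂ (trans A₀ (trans e₂ (cong (_+ M) (sym C₀))))
        -- After cancelling `K`, c₀ p² = c₁ p² + M, which forces p² ∣ M.
        pp∣M = ∣m+n∣m⇒∣n (subst (p * p ∣_) eqB (n∣m*n c₀)) (n∣m*n c₁)
        N = quotient pp∣M
        M≡ = m∣n⇒n≡quotient*m pp∣M
    in N , M≡ , q₀ , q₁ , q₂ , q₃ , q₄ , divide c₀ c₁ N M≡ eqB , divide c₀ c₂ N M≡ eqC
    where
    r = d₀ % p
    q₀ = d₀ / p
    q₁ = d₁ / p
    q₂ = d₂ / p
    q₃ = d₃ / p
    q₄ = d₄ / p
    K = common r p q₀ q₁ q₂ q₃ q₄
    c₀ = corr₀ q₀ q₁ q₂ q₃ q₄
    c₁ = corr₁ q₀ q₁ q₂ q₃ q₄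
    c₂ = corr₂ q₀ q₁ q₂ q₃ q₄

    restore : ∀ {s} d → d % p ≡ s → s + d / p * p ≡ d
    restore d refl = sym (m≡m%n+[m/n]*n d p)

    reduce : (corr : ℕ → ℕ → ℕ → ℕ → ℕ → ℕ) → d₀ % p ≡ r →
      d₁ % p ≡ r → d₂ % p ≡ r → d₃ % p ≡ r → d₄ % p ≡ r →
      corr (r + q₀ * p) (r + q₁ * p) (r + q₂ * p) (r + q₃ * p) (r + q₄ * p) ≡ corr d₀ d₁ d₂ d₃ d₄
    reduce corr s₀ s₁ s₂ s₃ s₄
      rewrite restore d₀ s₀ | restore d₁ s₁ | restore d₂ s₂ | restore d₃ s₃ | restore d₄ s₄ = refl

    strip : ∀ K A B → K + A * (p * p) ≡ K + B * (p * p) + M → A * (p * p) ≡ B * (p * p) + M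
    strip K A B eq = +-cancelˡ-≡ K _ _ (trans eq (+-assoc K _ M))

    divide : ∀ A B N → M ≡ N * (p * p) → A * (p * p) ≡ B * (p * p) + M → A ≡ B + N
    divide A B N M≡ eq = *-cancelʳ-≡ A (B + N) (p * p) {{m*n≢0 p p}} (trans eq
      (trans (cong (B * (p * p) +_) M≡) (sym (*-distribʳ-+ (p * p) B N))))

  norm-val≢1 : ∀ {M} → Norm M → ¬ HasVal p M 1
  norm-val≢1 {M} nm (p∣M , p²∤M) =
    let N , M≡ , _ = descent nm (subst (_∣ M) (*-identityʳ p) p∣M)
    in p²∤M (divides N (trans M≡ (cong (λ z → N * (p * z)) (sym (*-identityʳ p)))))

  norm-val-2+ : ∀ e {M} → Norm M → HasVal p M (2 + e) → ∃[ N ] Norm N × HasVal p N e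
  norm-val-2+ e {M} nm (pᵉ∣M , p¹⁺ᵉ∤M) =
    let N , M≡ , nn = descent nm (∣-trans (m∣m*n (p ^ suc e)) pᵉ∣M)
    in N , nn , m*[n*n]∣⇒m∣ e N (subst (p ^ (2 + e) ∣_) M≡ pᵉ∣M) ,
       λ d → p¹⁺ᵉ∤M (subst (p ^ (3 + e) ∣_) (sym M≡) (subst (_∣ N * (p * p)) (p*x*[p*p] p (p ^ e)) (*-monoˡ-∣ (p * p) d)))

  -- Each descent lowers the valuation by two, and it can never be 1, since p ∣ M already forces p²
  -- ∣ M.
  norm-val-even : ∀ e {M} → Norm M → HasVal p M e → 2 ∣ e
  norm-val-even zero          _  _ = 2 ∣0
  norm-val-even (suc zero)    nm v = contradiction v (norm-val≢1 nm)
  norm-val-even (suc (suc e)) nm v =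
    let N , nn , w = norm-val-2+ e nm v in ∣m∣n⇒∣m+n ∣-refl (norm-val-even e nn w)

-- Valuations

-- Euclid's lemma moves one factor p at a time into x.
^∣*⇒^∣ : ∀ {p} → Prime p → ∀ {y} → ¬ (p ∣ y) → ∀ k {x} → p ^ k ∣ x * y → p ^ k ∣ x
^∣*⇒^∣ pr p∤y zero    _ = 1∣ _
^∣*⇒^∣ {p} pr {y} p∤y (suc k) {x} d with euclidsLemma x y pr (∣-trans (m∣m*n (p ^ k)) d)
... | inj₂ p∣y = contradiction p∣y p∤y
... | inj₁ (divides q refl) = subst (p ^ suc k ∣_) (*-comm p q) (*-monoʳ-∣ p
  (^∣*⇒^∣ pr p∤y k (*-cancelˡ-∣ p {{prime⇒nonZero pr}} (subst (p ^ suc k ∣_) (swap q p y) d))))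
  where
  swap : ∀ q p y → q * p * y ≡ p * (q * y)
  swap = solve-∀

HasVal-*ʳ : ∀ {p} → Prime p → ∀ {x y e} → ¬ (p ∣ y) → HasVal p x e → HasVal p (x * y) e
HasVal-*ʳ pr {x} {y} {e} p∤y (d , nd) = ∣m⇒∣m*n y d , nd ∘ ^∣*⇒^∣ pr p∤y (suc e)

HasVal-*ʳ⁻¹ : ∀ {p} → Prime p → ∀ {x y e} → ¬ (p ∣ y) → HasVal p (x * y) e → HasVal p x e
HasVal-*ʳ⁻¹ pr {x} {y} {e} p∤y (d , nd) = ^∣*⇒^∣ pr p∤y e d , nd ∘ ∣m⇒∣m*n y

2∣⇒2∤suc : ∀ {e} → 2 ∣ e → ¬ (2 ∣ suc e)
2∣⇒2∤suc {e} d d′ with ∣1⇒≡1 (∣m+n∣m⇒∣n (subst (2 ∣_) (+-comm 1 e) d′) d)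
... | ()

-- Cancelling the 2 lowers the exponent by one and so flips its parity; exponent 0 is impossible for
-- an even number.
ValEven⇒ValOdd-half : ∀ M → ValEven 2 (2 * M) → ValOdd 2 M
ValEven⇒ValOdd-half M (zero  , (_ , nd) , _)  = contradiction (m∣m*n M) nd
ValEven⇒ValOdd-half M (suc e , (d , nd) , ev) =
  e , (*-cancelˡ-∣ 2 d , nd ∘ *-monoʳ-∣ 2) , λ ev′ → 2∣⇒2∤suc ev′ ev

prime∣2⇒≡2 : ∀ {p} → Prime p → p ∣ 2 → p ≡ 2
prime∣2⇒≡2 {p} pr p∣2 with prime⇒irreducible prime[2] p∣2
... | inj₁ refl = contradiction pr ¬prime[1]
... | inj₂ eq   = eq

-- An odd valuation is positive, so p divides x and hence not y. As p does not divide 2 either, x, x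
-- y = 2 M and M have the same valuation.
ValOdd-factor : ∀ {p} → Prime p → p ≢ 2 → ∀ {x y} → (p ∣ x → ¬ (p ∣ y)) → ∀ {M} → x * y ≡ 2 * M →
  ValOdd p x → ValOdd p M
ValOdd-factor pr p≢2 cop eq (zero , _ , odd) = contradiction (2 ∣0) odd
ValOdd-factor {p} pr p≢2 {x} {y} cop {M} eq (suc e , hv , odd) =
  suc e ,
  HasVal-*ʳ⁻¹ pr {e = suc e} (p≢2 ∘ prime∣2⇒≡2 pr)
    (subst (λ z → HasVal p z (suc e)) (trans eq (*-comm 2 M))
      (HasVal-*ʳ pr {e = suc e} (cop (∣-trans (m∣m*n (p ^ e)) (proj₁ hv))) hv)) ,
  odd

-- Meant for x = u + 1 and y = u - 1: a common prime factor would divide their difference 2.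
ValOdd-of-factorisation : ∀ {p} → Prime p → p ≢ 2 → ∀ {x y M} → y + 2 ≡ x → x * y ≡ 2 * M →
  ValOdd p x ⊎ ValOdd p y → ValOdd p M
ValOdd-of-factorisation {p} pr p≢2 {x} {y} refl eq = λ
  { (inj₁ v) → ValOdd-factor pr p≢2 coprime eq v
  ; (inj₂ v) → ValOdd-factor pr p≢2 (λ a b → coprime b a) (trans (*-comm y x) eq) v
  }
  where
  coprime : p ∣ y + 2 → ¬ (p ∣ y)
  coprime a b = p≢2 (prime∣2⇒≡2 pr (∣m+n∣m⇒∣n a b))

-- Correlations of periodic sequences

∑< : ℕ → (ℕ → ℕ) → ℕ
∑< n f = ∑[ i < n ] f (toℕ i)

∑-cong : ∀ n {f g : ℕ → ℕ} → (∀ i → f i ≡ g i) → ∑< n f ≡ ∑< n g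
∑-cong n f≗g = sum-cong-≗ {n} (λ i → f≗g (toℕ i))

∑-swap : ∀ m n (f : ℕ → ℕ → ℕ) → ∑< m (λ i → ∑< n (f i)) ≡ ∑< n (λ j → ∑< m (λ i → f i j))
∑-swap m n f = ∑-comm {m} {n} (λ i j → f (toℕ i) (toℕ j))

∑-*ˡ : ∀ n c f → ∑< n (λ i → c * f i) ≡ c * ∑< n f
∑-*ˡ n c f = sym (*-distribˡ-sum {n} c (f ∘ toℕ))

∑-last : ∀ n f → ∑< (suc n) f ≡ ∑< n f + f n
∑-last zero    f = +-comm (f 0) 0
∑-last (suc n) f = trans (cong (f 0 +_) (∑-last n (f ∘ suc))) (sym (+-assoc (f 0) _ _))

-- Both sides become the sum of the first n + 1 terms once `f 0`, which is also `f n`, is added.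
∑-rotate : ∀ n f → f n ≡ f 0 → ∑< n (f ∘ suc) ≡ ∑< n f
∑-rotate n f fn≡f0 = +-cancelˡ-≡ (f 0) _ _ (trans (∑-last n f) (trans (cong (∑< n f +_) fn≡f0) (+-comm _ (f 0))))

∑-shift : ∀ n f → (∀ i → f (i + n) ≡ f i) → ∀ t → ∑< n (λ i → f (i + t)) ≡ ∑< n f
∑-shift n f per zero    = ∑-cong n (λ i → cong f (+-identityʳ i))
∑-shift n f per (suc t) = trans (∑-cong n (λ i → cong f (+-suc i t)))
  (trans (∑-rotate n (λ i → f (i + t)) (trans (cong f (+-comm n t)) (per t))) (∑-shift n f per t))

∑-blocks : ∀ m g → ∑< (m * 5) g ≡ ∑< m (λ s → ∑< 5 (λ j → g (j + s * 5)))
∑-blocks zero    g = refl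
∑-blocks (suc m) g = trans (regroup (g 0) (g 1) (g 2) (g 3) (g 4) _)
  (cong (∑< 5 (λ j → g (j + 0)) +_)
    (trans (∑-blocks m (g ∘ (5 +_)))
      (∑-cong m (λ s → ∑-cong 5 (λ j → cong g (x∙yz≈y∙xz 5 j (s * 5)))))))
  where
  regroup : ∀ a b c d e x → a + (b + (c + (d + (e + x)))) ≡ (a + (b + (c + (d + (e + 0))))) + x
  regroup = solve-∀

correlation : ℕ → (ℕ → ℕ) → ℕ → ℕ
correlation n f t = ∑< n (λ i → f i * f (i + t))

module Section (m : ℕ) (f : ℕ → ℕ) (per : ∀ i → f (i + m * 5) ≡ f i) where

  F : ℕ → ℕ
  F = correlation (m * 5) f

  -- Defined at every x, not only below 5, so that `d (j + t)` needs no reduction.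
  d : ℕ → ℕ
  d x = ∑< m (λ s → f (x + s * 5))

  -- Passing to 5 + x advances s by one, and the term entering at s = m equals the one leaving at s
  -- = 0.
  d-periodic : ∀ x → d (5 + x) ≡ d x
  d-periodic x = trans (∑-cong m (λ s → cong f (shift x (s * 5))))
    (∑-rotate m (λ s → f (x + s * 5)) (trans (per x) (cong f (sym (+-identityʳ x)))))
    where
    shift : ∀ x y → 5 + x + y ≡ x + (5 + y)
    shift x y = trans (cong (_+ y) (+-comm 5 x)) (+-assoc x 5 y)

  d-periodic* : ∀ x s → d (x + s * 5) ≡ d x
  d-periodic* x zero    = cong d (+-identityʳ x)
  d-periodic* x (suc s) = trans (cong d (trans (sym (+-assoc x 5 (s * 5))) (cong (_+ s * 5) (+-comm x 5))))
    (trans (d-periodic (x + s * 5)) (d-periodic* x s))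

  -- Reduction of ℤ/n to ℤ/5 induces a homomorphism of group rings that respects inversion, so
  -- autocorrelation commutes with summing over classes.
  d-correlation : ∀ t → ∑< m (λ s → F (t + s * 5)) ≡ ∑< 5 (λ j → d j * d (j + t))
  d-correlation t = begin
    ∑< m (λ s → ∑< n (λ i → f i * f (i + (t + s * 5))))
      ≡⟨ ∑-swap m n (λ s i → f i * f (i + (t + s * 5))) ⟩
    ∑< n (λ i → ∑< m (λ s → f i * f (i + (t + s * 5))))
      ≡⟨ ∑-cong n (λ i → trans (∑-*ˡ m (f i) (λ s → f (i + (t + s * 5))))
           (cong (f i *_) (∑-cong m (λ s → cong f (sym (+-assoc i t (s * 5))))))) ⟩
    ∑< n (λ i → f i * d (i + t))
      ≡⟨ ∑-blocks m (λ i → f i * d (i + t)) ⟩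
    ∑< m (λ s → ∑< 5 (λ j → f (j + s * 5) * d (j + s * 5 + t)))
      ≡⟨ ∑-cong m (λ s → ∑-cong 5 (λ j → trans (cong (f (j + s * 5) *_)
           (trans (cong d (xy∙z≈xz∙y j (s * 5) t)) (d-periodic* (j + t) s)))
           (*-comm (f (j + s * 5)) (d (j + t))))) ⟩
    ∑< m (λ s → ∑< 5 (λ j → d (j + t) * f (j + s * 5)))
      ≡⟨ ∑-swap m 5 (λ s j → d (j + t) * f (j + s * 5)) ⟩
    ∑< 5 (λ j → ∑< m (λ s → d (j + t) * f (j + s * 5)))
      ≡⟨ ∑-cong 5 (λ j → trans (∑-*ˡ m (d (j + t)) (λ s → f (j + s * 5))) (*-comm (d (j + t)) (d j))) ⟩
    ∑< 5 (λ j → d j * d (j + t)) ∎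
    where
    open ≡.≡-Reasoning
    n = m * 5

section-norm : ∀ m .{{_ : NonZero m}} f → (∀ i → f (i + m * 5) ≡ f i) →
  ∀ M → (∀ t → 1 ≤ t → t < m * 5 → correlation (m * 5) f t + M ≡ correlation (m * 5) f 0) →
  Norm M
section-norm (suc m) f per M flat = d 0 , d 1 , d 2 , d 3 , d 4 ,
  trans (sym P₀) (trans (gap 1 (s≤s z≤n) (s≤s (s≤s z≤n))) (cong (_+ M) P₁)) ,
  trans (sym P₀) (trans (gap 2 (s≤s z≤n) (s≤s (s≤s (s≤s z≤n)))) (cong (_+ M) P₂))
  where
  open Section (suc m) f per
  k = suc m
  P : ℕ → ℕ
  P t = ∑< k (λ s → F (t + s * 5))

  flatten : ∀ a b c d e → a + (b + (c + (d + (e + 0)))) ≡ a + b + c + d + e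
  flatten = solve-∀

  P₀ : P 0 ≡ corr₀ (d 0) (d 1) (d 2) (d 3) (d 4)
  P₀ = trans (d-correlation 0) (flatten (d 0 * d 0) (d 1 * d 1) (d 2 * d 2) (d 3 * d 3) (d 4 * d 4))

  P₁ : P 1 ≡ corr₁ (d 0) (d 1) (d 2) (d 3) (d 4)
  P₁ = trans (d-correlation 1) (trans (flatten (d 0 * d 1) (d 1 * d 2) (d 2 * d 3) (d 3 * d 4) (d 4 * d 5))
    (cong (λ x → d 0 * d 1 + d 1 * d 2 + d 2 * d 3 + d 3 * d 4 + d 4 * x) (d-periodic 0)))

  P₂ : P 2 ≡ corr₂ (d 0) (d 1) (d 2) (d 3) (d 4)
  P₂ = trans (d-correlation 2) (trans (flatten (d 0 * d 2) (d 1 * d 3) (d 2 * d 4) (d 3 * d 5) (d 4 * d 6))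
    (cong₂ (λ x y → d 0 * d 2 + d 1 * d 3 + d 2 * d 4 + d 3 * x + d 4 * y) (d-periodic 0) (d-periodic 1)))

  -- Every term of `P t` is F 0 - M. In `P 0` the term s = 0 is F 0 itself and the others are F 0 -
  -- M, so the two sums differ by a single M.
  gap : ∀ t → 1 ≤ t → t < 5 → P 0 ≡ P t + M
  gap t 1≤t t<5 = begin
    F 0 + ∑< m (λ s → F (5 + s * 5))
      ≡⟨ cong₂ _+_ (sym (shifted 0 (s≤s z≤n))) (sum-cong-≗ {m} (λ s → +-cancelʳ-≡ M _ _ (trans
           (flat (5 + toℕ s * 5) (s≤s z≤n) (+-monoʳ-< 5 (*-monoˡ-< 5 (toℕ<n s)))) (sym (shifted (suc (toℕ s)) (s≤s (toℕ<n s))))))) ⟩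
    (F (t + 0) + M) + ∑< m (λ s → F (t + (5 + s * 5)))
      ≡⟨ xy∙z≈xz∙y (F (t + 0)) M _ ⟩
    P t + M ∎
    where
    open ≡.≡-Reasoning
    shifted : ∀ s → s < k → F (t + s * 5) + M ≡ F 0
    shifted s s<k = flat (t + s * 5) (≤-trans 1≤t (m≤m+n t _))
      (<-≤-trans (+-monoˡ-< (s * 5) t<5) (*-monoˡ-≤ 5 s<k))

-- Difference sets and binary sequences

[_] : Bool → ℕ
[ b ] = if b then 1 else 0

[∧] : ∀ a b → [ a ∧ b ] ≡ [ a ] * [ b ]
[∧] true  b = sym (+-identityʳ [ b ])
[∧] false b = refl

[]-idem : ∀ b → [ b ] * [ b ] ≡ [ b ]
[]-idem true  = refl
[]-idem false = refl

module _ {ℓ} {A : Set} {P : Pred A ℓ} (P? : Decidable P) where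

  length-filter-tabulate : ∀ {n} (h : Fin n → A) →
    length (filter P? (tabulate h)) ≡ ∑[ i < n ] [ does (P? (h i)) ]
  length-filter-tabulate {zero}  h = refl
  length-filter-tabulate {suc n} h with does (P? (h Fin.zero))
  ... | true  = cong suc (length-filter-tabulate (h ∘ Fin.suc))
  ... | false = length-filter-tabulate (h ∘ Fin.suc)

length-filter-× : ∀ {ℓ} {A B : Set} {P : Pred (A × B) ℓ} (P? : Decidable P) {m n} (h : Fin m → A) (k : Fin n → B) →
  length (filter P? (cartesianProduct (tabulate h) (tabulate k))) ≡ ∑[ i < m ] ∑[ j < n ] [ does (P? (h i , k j)) ]
length-filter-× P? {zero}      h k = refl
length-filter-× P? {suc m} {n} h k = begin
  length (filter P? (map (h₀ ,_) (tabulate k) ++ rest))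
    ≡⟨ cong length (filter-++ P? (map (h₀ ,_) (tabulate k)) rest) ⟩
  length (filter P? (map (h₀ ,_) (tabulate k)) ++ filter P? rest)
    ≡⟨ length-++ (filter P? (map (h₀ ,_) (tabulate k))) ⟩
  length (filter P? (map (h₀ ,_) (tabulate k))) + length (filter P? rest)
    ≡⟨ cong₂ _+_ (trans (cong (length ∘ filter P?) (map-tabulate k (h₀ ,_)))
                   (length-filter-tabulate P? (λ j → h₀ , k j)))
                 (length-filter-× P? (h ∘ Fin.suc) k) ⟩
  ∑[ j < n ] [ does (P? (h₀ , k j)) ] + ∑[ i < m ] ∑[ j < n ] [ does (P? (h (Fin.suc i) , k j)) ] ∎
  where
  open ≡.≡-Reasoning
  h₀ = h Fin.zero
  rest = cartesianProduct (tabulate (h ∘ Fin.suc)) (tabulate k)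

∑-unique : ∀ {ℓ n} {Q : Pred (Fin n) ℓ} (Q? : Decidable Q) (h : Fin n → ℕ) x → Q x → (∀ y → Q y → y ≡ x) →
  ∑[ y < n ] (h y * [ does (Q? y) ]) ≡ h x
∑-unique {n = suc n} Q? h x Qx unique = begin
  sum t                                     ≡⟨ sum-remove {i = x} t ⟩
  t x + ∑[ j < n ] t (Fin.punchIn x j)      ≡⟨ cong₂ _+_
    (trans (cong (λ b → h x * [ b ]) (dec-true (Q? x) Qx)) (*-identityʳ (h x)))
    (trans (sum-cong-≗ {n} (λ j → trans (cong (λ b → h (Fin.punchIn x j) * [ b ])
        (dec-false (Q? (Fin.punchIn x j)) (λ q → punchInᵢ≢i x j (unique _ q)))) (*-zeroʳ (h (Fin.punchIn x j)))))
      (sum-replicate-zero n)) ⟩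
  h x + 0                                   ≡⟨ +-identityʳ (h x) ⟩
  h x                                       ∎
  where
  open ≡.≡-Reasoning
  t = λ y → h y * [ does (Q? y) ]

χ : ∀ {n} → Subset n → Fin n → ℕ
χ D x = [ does (x ∈? D) ]

∣∣≡∑χ : ∀ {n} (D : Subset n) → ∣ D ∣ ≡ ∑[ x < n ] χ D x
∣∣≡∑χ []            = refl
∣∣≡∑χ (inside  ∷ D) = cong suc (∣∣≡∑χ D)
∣∣≡∑χ (outside ∷ D) = ∣∣≡∑χ D

module _ {n : ℕ} .{{_ : NonZero n}} where

  toℕ-mod : ∀ i → toℕ (i mod n) ≡ i % n
  toℕ-mod i = toℕ-fromℕ< (m%n<n i n)

  mod-cong : ∀ i j → i % n ≡ j % n → i mod n ≡ j mod n
  mod-cong i j eq = toℕ-injective (trans (toℕ-mod i) (trans eq (sym (toℕ-mod j))))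

  toℕ-mod-inverse : ∀ (x : Fin n) → toℕ x mod n ≡ x
  toℕ-mod-inverse x = toℕ-injective (trans (toℕ-mod (toℕ x)) (m<n⇒m%n≡m (toℕ<n x)))

%-absorbˡ : ∀ a b n .{{_ : NonZero n}} → (a % n + b) % n ≡ (a + b) % n
%-absorbˡ a b n = trans (%-distribˡ-+ (a % n) b n)
  (trans (cong (λ z → (z + b % n) % n) (m%n%n≡m%n a n)) (sym (%-distribˡ-+ a b n)))

module _ {n-1 : ℕ} where
  private n = suc n-1

  diffMod-solution : ∀ (y g : Fin n) → diffMod n ((toℕ y + toℕ g) mod n) y ≡ toℕ g
  diffMod-solution y g = begin
    (toℕ ((toℕ y + toℕ g) mod n) + (n ∸ toℕ y)) % n ≡⟨ cong (λ z → (z + (n ∸ toℕ y)) % n) (toℕ-mod {n} (toℕ y + toℕ g)) ⟩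
    ((toℕ y + toℕ g) % n + (n ∸ toℕ y)) % n         ≡⟨ %-absorbˡ (toℕ y + toℕ g) (n ∸ toℕ y) n ⟩
    (toℕ y + toℕ g + (n ∸ toℕ y)) % n               ≡⟨ cong (_% n) (rearrange (toℕ y) (toℕ g) (n ∸ toℕ y)) ⟩
    (toℕ g + (toℕ y + (n ∸ toℕ y))) % n             ≡⟨ cong (λ z → (toℕ g + z) % n) (m+[n∸m]≡n (<⇒≤ (toℕ<n y))) ⟩
    (toℕ g + n) % n                                 ≡⟨ [m+n]%n≡m%n (toℕ g) n ⟩
    toℕ g % n                                       ≡⟨ m<n⇒m%n≡m (toℕ<n g) ⟩
    toℕ g                                           ∎
    where
    open ≡.≡-Reasoning
    rearrange : ∀ a b c → a + b + c ≡ b + (a + c)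
    rearrange = solve-∀

  diffMod-unique : ∀ (y g x : Fin n) → diffMod n x y ≡ toℕ g → x ≡ (toℕ y + toℕ g) mod n
  diffMod-unique y g x eq = toℕ-injective (sym (begin
    toℕ ((toℕ y + toℕ g) mod n)                ≡⟨ toℕ-mod {n} (toℕ y + toℕ g) ⟩
    (toℕ y + toℕ g) % n                        ≡⟨ cong (_% n) (trans (cong (toℕ y +_) (sym eq)) (+-comm (toℕ y) _)) ⟩
    ((toℕ x + (n ∸ toℕ y)) % n + toℕ y) % n    ≡⟨ %-absorbˡ (toℕ x + (n ∸ toℕ y)) (toℕ y) n ⟩
    (toℕ x + (n ∸ toℕ y) + toℕ y) % n          ≡⟨ cong (_% n) (trans (+-assoc (toℕ x) _ _) (cong (toℕ x +_) (m∸n+n≡m (<⇒≤ (toℕ<n y))))) ⟩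
    (toℕ x + n) % n                            ≡⟨ [m+n]%n≡m%n (toℕ x) n ⟩
    toℕ x % n                                  ≡⟨ m<n⇒m%n≡m (toℕ<n x) ⟩
    toℕ x                                      ∎))
    where open ≡.≡-Reasoning

  -- For fixed y the difference g is attained by x = y + g alone, so the sum over x collapses and
  -- the count becomes an autocorrelation of `χ D`.
  reps≡∑ : ∀ (D : Subset n) g → reps n D g ≡ ∑[ y < n ] (χ D y * χ D ((toℕ y + toℕ g) mod n))
  reps≡∑ D g = begin
    reps n D g
      ≡⟨ length-filter-× (λ xy → (proj₁ xy ∈? D) ×-dec (proj₂ xy ∈? D) ×-dec (diffMod n (proj₁ xy) (proj₂ xy) ≟ toℕ g)) id id ⟩
    ∑[ x < n ] ∑[ y < n ] [ does (x ∈? D) ∧ (does (y ∈? D) ∧ does (diffMod n x y ≟ toℕ g)) ]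
      ≡⟨ ∑-comm {n} {n} (λ x y → [ does (x ∈? D) ∧ (does (y ∈? D) ∧ does (diffMod n x y ≟ toℕ g)) ]) ⟩
    ∑[ y < n ] ∑[ x < n ] [ does (x ∈? D) ∧ (does (y ∈? D) ∧ does (diffMod n x y ≟ toℕ g)) ]
      ≡⟨ sum-cong-≗ {n} (λ y → trans (sum-cong-≗ {n} (λ x → factor (does (x ∈? D)) (does (y ∈? D)) (does (diffMod n x y ≟ toℕ g))))
           (trans (sym (*-distribˡ-sum {n} (χ D y) (λ x → χ D x * [ does (diffMod n x y ≟ toℕ g) ])))
             (cong (χ D y *_) (∑-unique (λ x → diffMod n x y ≟ toℕ g) (χ D) ((toℕ y + toℕ g) mod n)
               (diffMod-solution y g) (diffMod-unique y g))))) ⟩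
    ∑[ y < n ] (χ D y * χ D ((toℕ y + toℕ g) mod n)) ∎
    where
    open ≡.≡-Reasoning
    factor : ∀ a b c → [ a ∧ (b ∧ c) ] ≡ [ b ] * ([ a ] * [ c ])
    factor a b c = trans ([∧] a (b ∧ c)) (trans (cong ([ a ] *_) ([∧] b c)) (swap [ a ] [ b ] [ c ]))
      where
      swap : ∀ x y z → x * (y * z) ≡ y * (x * z)
      swap = solve-∀

  -- Here k - λ = (u² - 1) / 8; the factor 2 turns the gap into 4 (k - λ) = M, the same as for
  -- binary sequences.
  doubled : Subset n → ℕ → ℕ
  doubled D i = 2 * χ D (i mod n)

  doubled-periodic : ∀ D i → doubled D (i + n) ≡ doubled D i
  doubled-periodic D i = cong (λ z → 2 * χ D z) (mod-cong {n} (i + n) i ([m+n]%n≡m%n i n))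

  correlation-doubled : ∀ D (g : Fin n) → correlation n (doubled D) (toℕ g) ≡ 4 * reps n D g
  correlation-doubled D g = begin
    ∑[ y < n ] (2 * χ D (toℕ y mod n) * (2 * χ D ((toℕ y + toℕ g) mod n)))
      ≡⟨ sum-cong-≗ {n} (λ y → trans (cong (λ z → 2 * χ D z * (2 * χ D ((toℕ y + toℕ g) mod n))) (toℕ-mod-inverse y))
           (four (χ D y) (χ D ((toℕ y + toℕ g) mod n)))) ⟩
    ∑[ y < n ] (4 * (χ D y * χ D ((toℕ y + toℕ g) mod n)))
      ≡⟨ *-distribˡ-sum {n} 4 (λ y → χ D y * χ D ((toℕ y + toℕ g) mod n)) ⟨
    4 * ∑[ y < n ] (χ D y * χ D ((toℕ y + toℕ g) mod n)) ≡⟨ cong (4 *_) (reps≡∑ D g) ⟨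
    4 * reps n D g ∎
    where
    open ≡.≡-Reasoning
    four : ∀ x y → 2 * x * (2 * y) ≡ 4 * (x * y)
    four = solve-∀

  correlation-doubled-0 : ∀ D → correlation n (doubled D) 0 ≡ 4 * ∣ D ∣
  correlation-doubled-0 D = begin
    ∑[ y < n ] (2 * χ D (toℕ y mod n) * (2 * χ D ((toℕ y + 0) mod n)))
      ≡⟨ sum-cong-≗ {n} (λ y → trans
           (cong₂ (λ a b → 2 * χ D a * (2 * χ D b)) (toℕ-mod-inverse y)
             (trans (cong (_mod n) (+-identityʳ (toℕ y))) (toℕ-mod-inverse y)))
           (trans (four (χ D y)) (cong (4 *_) ([]-idem (does (y ∈? D)))))) ⟩
    ∑[ y < n ] (4 * χ D y)      ≡⟨ *-distribˡ-sum {n} 4 (χ D) ⟨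
    4 * ∑[ y < n ] χ D y        ≡⟨ cong (4 *_) (∣∣≡∑χ D) ⟨
    4 * ∣ D ∣   ∎
    where
    open ≡.≡-Reasoning
    four : ∀ x → 2 * x * (2 * x) ≡ 4 * (x * x)
    four = solve-∀

  diffSet-flat : ∀ {k lam M} D → IsCyclicDiffSet n k lam D → 4 * lam + M ≡ 4 * k →
    ∀ t → 1 ≤ t → t < n → correlation n (doubled D) t + M ≡ correlation n (doubled D) 0
  diffSet-flat {k} {lam} {M} D (card , rep) eq (suc t) (s≤s _) t<n = begin
    correlation n (doubled D) (suc t) + M     ≡⟨ cong (λ z → correlation n (doubled D) z + M) (toℕ-fromℕ< t<n) ⟨
    correlation n (doubled D) (toℕ g) + M     ≡⟨ cong (_+ M) (correlation-doubled D g) ⟩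
    4 * reps n D g + M                        ≡⟨ cong (λ z → 4 * z + M) (rep g (λ g≡0 → 1+n≢0 (trans (sym (toℕ-fromℕ< t<n)) g≡0))) ⟩
    4 * lam + M                               ≡⟨ eq ⟩
    4 * k                                     ≡⟨ cong (4 *_) card ⟨
    4 * ∣ D ∣                 ≡⟨ correlation-doubled-0 D ⟨
    correlation n (doubled D) 0               ∎
    where
    open ≡.≡-Reasoning
    g = Fin.fromℕ< t<n

Sign : ℤ → Set
Sign x = (x ≡ ℤ.+ 1) ⊎ (x ≡ ℤ.- (ℤ.+ 1))

-- For a sign, a + 1 is 0 or 2, so the absolute value only carries it from ℤ to ℕ.
shifted : (ℕ → ℤ) → ℕ → ℕ
shifted a i = ℤ.∣ a i ℤ.+ ℤ.+ 1 ∣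

-- This is x y + (x + 1) + (y + 1) = (x + 1)(y + 1) + 1.
sign-product : ∀ {x y} → Sign x → Sign y → let f = λ z → ℤ.∣ z ℤ.+ ℤ.+ 1 ∣ in
  x ℤ.* y ℤ.+ ℤ.+ (f x + f y) ≡ ℤ.+ (f x * f y + 1)
sign-product (inj₁ refl) (inj₁ refl) = refl
sign-product (inj₁ refl) (inj₂ refl) = refl
sign-product (inj₂ refl) (inj₁ refl) = refl
sign-product (inj₂ refl) (inj₂ refl) = refl

sign-square : ∀ {x} → Sign x → let f = ℤ.∣ x ℤ.+ ℤ.+ 1 ∣ in f * f ≡ f + f
sign-square (inj₁ refl) = refl
sign-square (inj₂ refl) = refl

sumℤ-+ : ∀ n (g : ℕ → ℤ) (p q : ℕ → ℕ) → (∀ i → g i ℤ.+ ℤ.+ p i ≡ ℤ.+ q i) → sumℤ n g ℤ.+ ℤ.+ ∑< n p ≡ ℤ.+ ∑< n q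
sumℤ-+ n g p q eq = go n id
  where
  open ≡.≡-Reasoning
  middle : ∀ w x y z → (w ℤ.+ x) ℤ.+ (y ℤ.+ z) ≡ (w ℤ.+ y) ℤ.+ (x ℤ.+ z)
  middle = ℤ-Solver.solve-∀
  -- Generalised over h, because the tail of `applyUpTo h` is `applyUpTo (h ∘ suc)`.
  go : ∀ n (h : ℕ → ℕ) → foldr (λ i acc → g i ℤ.+ acc) (ℤ.+ 0) (applyUpTo h n) ℤ.+ ℤ.+ ∑< n (p ∘ h) ≡ ℤ.+ ∑< n (q ∘ h)
  go zero    h = refl
  go (suc n) h = trans (middle (g (h 0)) _ (ℤ.+ p (h 0)) _) (cong₂ ℤ._+_ (eq (h 0)) (go n (h ∘ suc)))

-- Summing `sign-product` gives C(t) + 2 Σ f = F t + n. By `sign-square`, 2 Σ f = F 0, and with C(t)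
-- = 1 and n = M + 1 the claim remains.
sequence-flat : ∀ {n M} a → n ≡ suc M → IsBinarySeq n a → (∀ t → 1 ≤ t → t < n → autocorr n a t ≡ ℤ.+ 1) →
  ∀ t → 1 ≤ t → t < n → correlation n (shifted a) t + M ≡ correlation n (shifted a) 0
sequence-flat {n} {M} a refl (sign , per) auto t 1≤t t<n = suc-injective (begin
  suc (F t + M)                         ≡⟨ +-suc (F t) M ⟨
  F t + n                               ≡⟨ ℤ.+-injective (trans (sym total) (cong (ℤ._+ ℤ.+ ∑< n (λ i → f i + f (i + t))) (auto t 1≤t t<n))) ⟩
  suc (∑< n (λ i → f i + f (i + t)))    ≡⟨ cong suc (begin
    ∑< n (λ i → f i + f (i + t))          ≡⟨ ∑-+ (λ i → f i) (λ i → f (i + t)) ⟩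
    ∑< n f + ∑< n (λ i → f (i + t))       ≡⟨ cong (∑< n f +_) (∑-shift n f (λ i → cong (λ z → ℤ.∣ z ℤ.+ ℤ.+ 1 ∣) (per i)) t) ⟩
    ∑< n f + ∑< n f                       ≡⟨ ∑-+ f f ⟨
    ∑< n (λ i → f i + f i)                ≡⟨ ∑-cong n (λ i → trans (cong (λ z → f i * f z) (+-identityʳ i)) (sign-square (sign i))) ⟨
    F 0                                   ∎) ⟩
  suc (F 0)                             ∎)
  where
  open ≡.≡-Reasoning
  f = shifted a
  F = correlation n f

  ∑-+ : ∀ p q → ∑< n (λ i → p i + q i) ≡ ∑< n p + ∑< n q
  ∑-+ p q = ∑-distrib-+ {n} (p ∘ toℕ) (q ∘ toℕ)

  ∑-1 : ∀ n → ∑< n (λ _ → 1) ≡ n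
  ∑-1 zero    = refl
  ∑-1 (suc n) = cong suc (∑-1 n)

  total : autocorr n a t ℤ.+ ℤ.+ ∑< n (λ i → f i + f (i + t)) ≡ ℤ.+ (F t + n)
  total = trans (sumℤ-+ n (λ i → a i ℤ.* a (i + t)) (λ i → f i + f (i + t)) (λ i → f i * f (i + t) + 1)
      (λ i → sign-product (sign i) (sign (i + t))))
    (cong ℤ.+_ (trans (∑-+ (λ i → f i * f (i + t)) (λ _ → 1)) (cong (F t +_) (∑-1 n))))

-- The parameters n, k, λ in terms of u

2∣n*suc-n : ∀ n → 2 ∣ n * suc n
2∣n*suc-n zero    = 2 ∣0
2∣n*suc-n (suc n) = subst (2 ∣_) (step n) (∣m∣n⇒∣m+n (2∣n*suc-n n) (m∣m*n (suc n)))
  where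
  step : ∀ n → n * suc n + 2 * suc n ≡ suc n * suc (suc n)
  step = solve-∀

-- The substitution u = 3 + 2v removes truncated subtraction and makes the divisions exact: with w =
-- v + 1 = (u - 1) / 2, one gets M = 2w(w + 1), n = M + 1 = 5(m + 1), k = w², λ = vw / 2.
record Parameters (u : ℕ) : Set where
  field
    v m : ℕ
    u≡ : u ≡ 3 + 2 * v
    5∣n : suc (2 * (suc v * suc (suc v))) ≡ suc m * 5

  w M : ℕ
  w = suc v
  M = 2 * (w * suc w)

  n≡ : (u ^ 2 + 1) / 2 ≡ suc M
  n≡ = trans (cong (_/ 2) (trans (cong (λ z → z ^ 2 + 1) u≡) (expand v))) ((m*n/n≡m (suc M) 2))
    where
    expand : ∀ v → (3 + 2 * v) * ((3 + 2 * v) * 1) + 1 ≡ suc (2 * (suc v * suc (suc v))) * 2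
    expand = solve-∀

  k≡ : ((u ∸ 1) ^ 2) / 4 ≡ w * w
  k≡ = trans (cong (_/ 4) (trans (cong (λ z → (z ∸ 1) ^ 2) u≡) (expand v))) (m*n/n≡m (w * w) 4)
    where
    expand : ∀ v → (2 + 2 * v) * ((2 + 2 * v) * 1) ≡ suc v * suc v * 4
    expand = solve-∀

  -- The division by 8 in λ is exact because v (v + 1) is even; its half is q.
  flat≡ : 4 * (((u ∸ 1) * (u ∸ 3)) / 8) + M ≡ 4 * (((u ∸ 1) ^ 2) / 4)
  flat≡ with 2∣n*suc-n v
  ... | divides q q≡ = trans (cong (λ z → 4 * z + M) lam≡) (trans (arith q v (sym q≡)) (cong (4 *_) (sym k≡)))
    where
    expand : ∀ v → (2 + 2 * v) * (2 * v) ≡ v * suc v * 4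
    expand = solve-∀
    double : ∀ q → q * 2 * 4 ≡ q * 8
    double = solve-∀
    lam≡ : ((u ∸ 1) * (u ∸ 3)) / 8 ≡ q
    lam≡ = trans (cong (_/ 8) (trans (cong (λ z → (z ∸ 1) * (z ∸ 3)) u≡)
      (trans (expand v) (trans (cong (_* 4) q≡) (double q))))) (m*n/n≡m q 8)
    arith : ∀ q v → q * 2 ≡ v * suc v → 4 * q + 2 * (suc v * suc (suc v)) ≡ 4 * (suc v * suc v)
    arith q v eq = trans (a q v) (trans (cong (λ z → 2 * z + 2 * (suc v * suc (suc v))) eq) (b v))
      where
      a : ∀ q v → 4 * q + 2 * (suc v * suc (suc v)) ≡ 2 * (q * 2) + 2 * (suc v * suc (suc v))
      a = solve-∀
      b : ∀ v → 2 * (v * suc v) + 2 * (suc v * suc (suc v)) ≡ 4 * (suc v * suc v)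
      b = solve-∀

  u²-1≡ : u ^ 2 ∸ 1 ≡ 2 * M
  u²-1≡ = trans (cong (λ z → z ^ 2 ∸ 1) u≡) (cong (_∸ 1) (expand v))
    where
    expand : ∀ v → (3 + 2 * v) * ((3 + 2 * v) * 1) ≡ suc (2 * (2 * (suc v * suc (suc v))))
    expand = solve-∀

  [u+1][u-1]≡ : (u + 1) * (u ∸ 1) ≡ 2 * M
  [u+1][u-1]≡ = trans (cong (λ z → (z + 1) * (z ∸ 1)) u≡) (expand v)
    where
    expand : ∀ v → (3 + 2 * v + 1) * (2 + 2 * v) ≡ 2 * (2 * (suc v * suc (suc v)))
    expand = solve-∀

  u-1+2≡u+1 : u ∸ 1 + 2 ≡ u + 1
  u-1+2≡u+1 = trans (cong (λ z → z ∸ 1 + 2) u≡) (trans (expand v) (cong (_+ 1) (sym u≡)))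
    where
    expand : ∀ v → 2 + 2 * v + 2 ≡ 3 + 2 * v + 1
    expand = solve-∀

parameters : ∀ u → u % 10 ≡ 3 ⊎ u % 10 ≡ 7 → Parameters u
parameters u (inj₁ r) = record
  { v = 5 * q
  -- From n = 50q² + 30q + 5 for u = 10q + 3.
  ; m = 10 * q * q + 6 * q
  ; u≡ = trans (trans (m≡m%n+[m/n]*n u 10) (cong (_+ q * 10) r)) (expand q)
  ; 5∣n = n q
  }
  where
  q = u / 10
  expand : ∀ q → 3 + q * 10 ≡ 3 + 2 * (5 * q)
  expand = solve-∀
  n : ∀ q → suc (2 * (suc (5 * q) * suc (suc (5 * q)))) ≡ suc (10 * q * q + 6 * q) * 5
  n = solve-∀
parameters u (inj₂ r) = record
  { v = 2 + 5 * q
  -- From n = 50q² + 70q + 25 for u = 10q + 7.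
  ; m = 4 + 10 * q * q + 14 * q
  ; u≡ = trans (trans (m≡m%n+[m/n]*n u 10) (cong (_+ q * 10) r)) (expand q)
  ; 5∣n = n q
  }
  where
  q = u / 10
  expand : ∀ q → 7 + q * 10 ≡ 3 + 2 * (2 + 5 * q)
  expand = solve-∀
  n : ∀ q → suc (2 * (suc (2 + 5 * q) * suc (suc (2 + 5 * q)))) ≡ suc (4 + 10 * q * q + 14 * q) * 5
  n = solve-∀

-- Flat correlations against an odd valuation

ValOdd⇒no-flat : ∀ {p M n} m .{{_ : NonZero m}} → n ≡ m * 5 → Prime p → NegOneIsPower p → ValOdd p M →
  ∀ f → (∀ i → f (i + n) ≡ f i) →
  ¬ (∀ t → 1 ≤ t → t < n → correlation n f t + M ≡ correlation n f 0)
ValOdd⇒no-flat {p} {M} m refl pr inert (e , v , odd) f per flat =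
  odd (norm-val-even {{prime⇒nonZero pr}} pr inert e (section-norm m f per M flat) v)

theorem2p5 : (u : ℕ) → 1 ≤ u → (u % 10 ≡ 3 ⊎ u % 10 ≡ 7) →
    (ValEven 2 (u ^ 2 ∸ 1)
    ⊎ ∃[ p ] (Prime p × p ≢ 2 × (p % 5 ≡ 2 ⊎ p % 5 ≡ 3 ⊎ p % 5 ≡ 4)
    × (ValOdd p (u + 1) ⊎ ValOdd p (u ∸ 1)))) →
    (¬ (∃[ D ] IsCyclicDiffSet ((u ^ 2 + 1) / 2) (((u ∸ 1) ^ 2) / 4) (((u ∸ 1) * (u ∸ 3)) / 8) D))
    × (¬ (∃[ a ] (IsBinarySeq ((u ^ 2 + 1) / 2) a
    × ((t : ℕ) → 1 ≤ t → t < (u ^ 2 + 1) / 2 → autocorr ((u ^ 2 + 1) / 2) a t ≡ ℤ.+ 1))))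
theorem2p5 u _ u%10 cond = no-diffSet , no-sequence
  where
  open Parameters (parameters u u%10)

  exceptional : ∃[ p ] Prime p × NegOneIsPower p × ValOdd p M
  exceptional = case cond of λ
    -- The prime 2 is itself 2 mod 5, and M is half of u² - 1, so the even valuation becomes an odd
    -- one.
    { (inj₁ even)                        → 2 , prime[2] , inj₁ refl ,
        ValEven⇒ValOdd-half M (subst (ValEven 2) u²-1≡ even)
    ; (inj₂ (p , pr , p≢2 , inert , odd)) → p , pr , inert ,
        ValOdd-of-factorisation pr p≢2 u-1+2≡u+1 [u+1][u-1]≡ odd
    }

  no-flat : ∀ f → (∀ i → f (i + suc M) ≡ f i) →
    ¬ (∀ t → 1 ≤ t → t < suc M → correlation (suc M) f t + M ≡ correlation (suc M) f 0)
  no-flat = let p , pr , inert , odd = exceptional in ValOdd⇒no-flat (suc m) 5∣n pr inert odd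

  k lam : ℕ
  k = ((u ∸ 1) ^ 2) / 4
  lam = ((u ∸ 1) * (u ∸ 3)) / 8

  no-diffSet : ¬ (∃[ D ] IsCyclicDiffSet ((u ^ 2 + 1) / 2) k lam D)
  no-diffSet ds =
    -- The type of D depends on n, so the whole existential is transported.
    let D , isD = subst (λ n → ∃[ D ] IsCyclicDiffSet n k lam D) n≡ ds
    in no-flat (doubled D) (doubled-periodic D) (diffSet-flat D isD flat≡)

  no-sequence : ¬ (∃[ a ] (IsBinarySeq ((u ^ 2 + 1) / 2) a
    × ((t : ℕ) → 1 ≤ t → t < (u ^ 2 + 1) / 2 → autocorr ((u ^ 2 + 1) / 2) a t ≡ ℤ.+ 1)))
  no-sequence sq =
    let a , isB , auto = subst (λ n → ∃[ a ] (IsBinarySeq n a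
          × ((t : ℕ) → 1 ≤ t → t < n → autocorr n a t ≡ ℤ.+ 1))) n≡ sq
    in no-flat (shifted a) (λ i → cong (λ z → ℤ.∣ z ℤ.+ ℤ.+ 1 ∣) (proj₂ isB i))
         (sequence-flat a refl isB auto)
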